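{- Let $q$ be a prime power and $\nu\ge 1$ an integer. The symplectic graph $Sp(2\nu,q)$ is a strongly regular graph with parameters $$\left(\frac{q^{2\nu}-1}{q-1},\; q^{2\nu-1},\; q^{2\nu-2}(q-1),\; q^{2\nu-2}(q-1)\right)$$ and eigenvalues $q^{2\nu-1}$, $q^{\nu-1}$ and $-q^{\nu-1}$.
   Context: Let $\mathbb{F}_q$ be the finite field with $q$ elements (any characteristic), and let $\mathbb{F}_q^{(2\nu)}$ be the $2\nu$-dimensional space of row vectors over $\mathbb{F}_q$. Let $K$ be the $2\nu\times 2\nu$ block diagonal matrix over $\mathbb{F}_q$ with $\nu$ diagonal blocks all equal to $\begin{pmatrix}0&1\\-1&0\end{pmatrix}$. For a nonzero row vector $\alpha$, $[\alpha]$ denotes the one-dimensional subspace spanned by $\alpha$. The symplectic graph $Sp(2\nu,q)$ is the graph whose vertices are the one-dimensional subspaces of $\mathbb{F}_q^{(2\nu)}$, with $[\alpha]$ adjacent to $[\beta]$ if and only if $\alpha K\,{}^t\!\beta\neq 0$ (where ${}^t\!\beta$ is the transpose of $\beta$). A finite simple graph is strongly regular with parameters $(v,k,\lambda,\mu)$ if it has $v$ vertices, every vertex has degree $k$, any two distinct adjacent vertices have exactly $\lambda$ common neighbours, and any two distinct non-adjacent vertices have exactly $\mu$ common neighbours (a condition that is vacuous if the graph is complete). The eigenvalues of a graph are the eigenvalues of its adjacency matrix.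
   Formalization: For ν=1 the graph is complete on q+1 vertices, with eigenvalues q and −1 only, so the listed q^(ν−1)=1 is not an eigenvalue; the formal theorem lists q^(ν−1) only for ν≥2. Eigenvalues are taken in any field of characteristic zero. -}

module Defs where

open import Level using (Level; _⊔_) renaming (suc to lsuc)
open import Algebra.Bundles using (CommutativeRing)
open import Algebra.Apartness.Bundles using (HeytingCommutativeRing; HeytingField)
import Algebra.Apartness.Properties.HeytingCommutativeRing as HeytingProperties
import Algebra.Properties.Ring as RingProperties
import Algebra.Properties.Semiring.Mult as Mult
import Algebra.Properties.Semiring.Sum as Sum
open import Data.Bool.Base using (true; false; if_then_else_)
open import Data.Fin.Base using (Fin; zero; suc; quotient; remainder)
import Data.Fin.Properties as Fin
open import Data.Nat.Base as ℕ using (ℕ; zero; suc)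
import Data.Nat.Properties as ℕ
open import Data.Nat.Primality using (Prime; prime⇒nonTrivial)
open import Data.Product.Base using (Σ; ∃₂; ∃-syntax; _×_; _,_; proj₁; proj₂)
open import Data.Vec.Functional using (Vector)
open import Function.Base using (_∘_)
open import Function.Bundles using (Inverse)
open import Relation.Binary.Bundles using (Setoid)
open import Relation.Binary.Core using (Rel)
open import Relation.Binary.Definitions
  using (Decidable; Irreflexive; Symmetric; _Respects₂_)
import Relation.Binary.Construct.On as On
import Relation.Binary.Reasoning.Setoid as ≈-Reasoning
open import Relation.Binary.PropositionalEquality.Core as ≡ using (_≡_)
import Relation.Binary.PropositionalEquality.Properties as ≡
open import Relation.Nullary.Decidable.Core using (Dec; yes; no; does; map′)
open import Relation.Nullary.Negation.Core using (¬_; contradiction)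
open import Relation.Unary using (Pred; _≐_)
open import Relation.Unary.Relation.Binary.Equality using (≐-isEquivalence)
import Data.Vec.Functional.Relation.Binary.Equality.Setoid as VecEquality

private
  variable
    c ℓ ℓ₁ ℓ₂ r : Level

IsPrimePower : ℕ → Set
IsPrimePower q = ∃₂ λ p k → Prime p × 1 ℕ.≤ k × q ≡ p ℕ.^ k

primePower⇒nonZero-∸1 : ∀ {q} → IsPrimePower q → ℕ.NonZero (q ℕ.∸ 1)
primePower⇒nonZero-∸1 (p , k , p-prime , 1≤k , ≡.refl) =
  ℕ.>-nonZero (ℕ.m<n⇒0<n∸m 1<p^k)
  where
  instance
    _ = prime⇒nonTrivial p-prime
    _ = ℕ.nonTrivial⇒nonZero p
  1<p^k : 1 ℕ.< p ℕ.^ k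
  1<p^k = ℕ.≤-trans (ℕ.nonTrivial⇒n>1 p)
            (≡.subst (ℕ._≤ p ℕ.^ k) (ℕ.^-identityʳ p) (ℕ.^-monoʳ-≤ p 1≤k))

HasSize : Setoid c ℓ → ℕ → Set (c ⊔ ℓ)
HasSize S n = Inverse S (≡.setoid (Fin n))

-- The elements of S satisfying P, compared as elements of S.
Restrict : (S : Setoid c ℓ) → Pred (Setoid.Carrier S) r → Setoid (c ⊔ r) ℓ
Restrict S P = On.setoid {B = Σ (Setoid.Carrier S) P} S proj₁

record SimpleGraph c ℓ r : Set (lsuc (c ⊔ ℓ ⊔ r)) where
  field
    vertices   : Setoid c ℓ
  open Setoid vertices public renaming (Carrier to Vertex) using (_≈_; _≉_)
  field
    Adj        : Rel Vertex r
    adj?       : Decidable Adj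
    adj-resp-≈ : Adj Respects₂ _≈_
    adj-sym    : Symmetric Adj
    adj-irrefl : Irreflexive _≈_ Adj

  neighbours : Vertex → Setoid (c ⊔ r) ℓ
  neighbours u = Restrict vertices (Adj u)

  commonNeighbours : Vertex → Vertex → Setoid (c ⊔ r) ℓ
  commonNeighbours u w = Restrict vertices λ x → Adj u x × Adj w x

record IsStronglyRegular (G : SimpleGraph c ℓ r) (v k l m : ℕ)
                         : Set (c ⊔ ℓ ⊔ r) where
  open SimpleGraph G
  field
    order       : HasSize vertices v
    degree      : ∀ u → HasSize (neighbours u) k
    adjacent    : ∀ u w → u ≉ w → Adj u w → HasSize (commonNeighbours u w) l
    nonAdjacent : ∀ u w → u ≉ w → ¬ Adj u w → HasSize (commonNeighbours u w) m

-- In a Heyting field x # y holds exactly when x - y is invertible, so x ≠ 0 is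
-- rendered as x # 0# (for a finite field, where # is decidable, this is the
-- same as the negation of x ≈ 0#).

module LinearAlgebra (F : HeytingField c ℓ₁ ℓ₂) where
  open HeytingField F public using
    ( Carrier; _≈_; _#_; _+_; _*_; -_; _-_; 0#; 1#; heytingCommutativeRing
    ; #⇒invertible; #-irrefl )
  open HeytingProperties heytingCommutativeRing public

  commutativeRing : CommutativeRing c ℓ₁
  commutativeRing = HeytingCommutativeRing.commutativeRing heytingCommutativeRing

  open CommutativeRing commutativeRing public using (setoid; ring; semiring)
  open Sum semiring public using (sum)
  open Mult semiring public using () renaming (_×_ to _·ℕ_)
  open VecEquality setoid public using (_≋_)

  Matrix : ℕ → Set c
  Matrix n = Fin n → Fin n → Carrier

  NonZeroVector : ∀ {n} → Pred (Vector Carrier n) ℓ₂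
  NonZeroVector x = ∃[ i ] x i # 0#

  infixr 7 _·_
  _·_ : ∀ {n} → Carrier → Vector Carrier n → Vector Carrier n
  (a · x) i = a * x i

  -- Superscripts ʳ and ᶜ mark the row, respectively column, vector.
  _ʳ*_ : ∀ {n} → Vector Carrier n → Matrix n → Vector Carrier n
  (x ʳ* M) j = sum λ i → x i * M i j

  _*ᶜ_ : ∀ {n} → Matrix n → Vector Carrier n → Vector Carrier n
  (M *ᶜ x) i = sum λ j → M i j * x j

  _∙_ : ∀ {n} → Vector Carrier n → Vector Carrier n → Carrier
  x ∙ y = sum λ i → x i * y i

  Span : ∀ {n} → Vector Carrier n → Pred (Vector Carrier n) (c ⊔ ℓ₁)
  Span x y = ∃[ a ] y ≋ a · x

  IsEigenvalue : ∀ {n} → Matrix n → Carrier → Set (c ⊔ ℓ₁ ⊔ ℓ₂)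
  IsEigenvalue M t = ∃[ x ] NonZeroVector x × (M *ᶜ x) ≋ t · x

  fromℕ : ℕ → Carrier
  fromℕ n = n ·ℕ 1#

  CharacteristicZero : Set ℓ₂
  CharacteristicZero = ∀ n → fromℕ (suc n) # 0#

-- The library has neither ℝ nor ℂ, so the entries 0 and 1 are taken in an
-- arbitrary field L, to be thought of as a field of characteristic zero.
adjacencyMatrix : ∀ {a b d n} (G : SimpleGraph c ℓ r) →
                  HasSize (SimpleGraph.vertices G) n →
                  (L : HeytingField a b d) → LinearAlgebra.Matrix L n
adjacencyMatrix G enum L i j =
  if does (adj? (Inverse.from enum i) (Inverse.from enum j)) then 1# else 0#
  where
  open SimpleGraph G
  open HeytingField L using (0#; 1#)

record FiniteField (q : ℕ) c ℓ₁ ℓ₂ : Set (lsuc (c ⊔ ℓ₁ ⊔ ℓ₂)) where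
  field
    heytingField : HeytingField c ℓ₁ ℓ₂
  open LinearAlgebra heytingField using (setoid)
  field
    size         : HasSize setoid q

module Symplectic (F : HeytingField c ℓ₁ ℓ₂) where
  open LinearAlgebra F public

  J : Matrix 2
  J zero       zero       = 0#
  J zero       (suc zero) = 1#
  J (suc zero) zero       = - 1#
  J (suc zero) (suc zero) = 0#

  -- Index i lies in block number ⌊i/2⌋, at position i mod 2.
  K : ∀ ν → Matrix (ν ℕ.* 2)
  K ν i j = if does (quotient {ν} 2 i Fin.≟ quotient {ν} 2 j)
            then J (remainder {ν} 2 i) (remainder {ν} 2 j)
            else 0#

  form : ∀ ν (α β : Vector Carrier (ν ℕ.* 2)) → Carrier
  form ν α β = (α ʳ* K ν) ∙ β

  -- A nonzero vector α stands for the subspace [α]; two of them are equal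
  -- as points when their spans coincide.
  points : ℕ → Setoid (c ⊔ ℓ₂) (c ⊔ ℓ₁)
  points n = record
    { Carrier       = Σ (Vector Carrier n) NonZeroVector
    ; _≈_           = λ α β → Span (proj₁ α) ≐ Span (proj₁ β)
    ; isEquivalence = On.isEquivalence (Span ∘ proj₁) ≐-isEquivalence
    }

  private
    open CommutativeRing commutativeRing
      using ( refl; sym; trans; +-cong; +-congˡ; +-congʳ; +-identityˡ
            ; +-identityʳ; *-congˡ; *-congʳ; *-assoc; *-comm
            ; *-identityˡ; -‿cong; -‿inverseʳ; zeroˡ; zeroʳ )
    open RingProperties ring
      using ( -‿distribˡ-*; -‿distribʳ-*; -‿involutive; -0#≈0#; -1*x≈-x )
    open Sum semiring
      using (sum-cong-≋; ∑-comm; ∑-distrib-+; *-distribˡ-sum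
            ; *-distribʳ-sum)
    open ≈-Reasoning setoid

    xy#0⇒y#0 : ∀ {x y} → x * y # 0# → y # 0#
    xy#0⇒y#0 {x} {y} xy#0 with #⇒invertible xy#0
    ... | z , z*xy≈1 , _ = invertibleˡ⇒# (z * x , (begin
      z * x * (y - 0#)   ≈⟨ *-congˡ (x-0≈x y) ⟩
      z * x * y          ≈⟨ *-assoc z x y ⟩
      z * (x * y)        ≈⟨ *-congˡ (x-0≈x (x * y)) ⟨
      z * (x * y - 0#)   ≈⟨ z*xy≈1 ⟩
      1#                 ∎))

    -x#0⇒x#0 : ∀ {x} → - x # 0# → x # 0#
    -x#0⇒x#0 {x} -x#0 = xy#0⇒y#0 (#-congʳ (sym (-1*x≈-x x)) -x#0)

    sum-neg : ∀ {n} (f : Vector Carrier n) → sum (λ i → - f i) ≈ - sum f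
    sum-neg f = begin
      sum (λ i → - f i)        ≈⟨ sum-cong-≋ (λ i → -1*x≈-x (f i)) ⟨
      sum (λ i → - 1# * f i)   ≈⟨ *-distribˡ-sum (- 1#) f ⟨
      - 1# * sum f             ≈⟨ -1*x≈-x (sum f) ⟩
      - sum f                  ∎

    sum-alternating : ∀ {n} (f : Matrix n) → (∀ i → f i i ≈ 0#) →
                      (∀ i j → f i j ≈ - f j i) →
                      sum (λ i → sum (f i)) ≈ 0#
    sum-alternating {zero}  f diag skew = refl
    sum-alternating {suc n} f diag skew = begin
      (f zero zero + S) + sum (λ i → f (suc i) zero + sum (f (suc i) ∘ suc))
        ≈⟨ +-cong (trans (+-congʳ (diag zero)) (+-identityˡ S))
                  (∑-distrib-+ (λ i → f (suc i) zero) _) ⟩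
      S + (sum (λ i → f (suc i) zero) + sum (λ i → sum (f (suc i) ∘ suc)))
        ≈⟨ +-congˡ (+-cong (trans (sum-cong-≋ λ i → skew (suc i) zero)
                                  (sum-neg (f zero ∘ suc)))
                           (sum-alternating (λ i j → f (suc i) (suc j))
                             (diag ∘ suc) (λ i j → skew (suc i) (suc j)))) ⟩
      S + (- S + 0#)   ≈⟨ +-congˡ (+-identityʳ (- S)) ⟩
      S - S            ≈⟨ -‿inverseʳ S ⟩
      0#               ∎
      where S = sum (f zero ∘ suc)

    J-diag : ∀ i → J i i ≈ 0#
    J-diag zero       = refl
    J-diag (suc zero) = refl

    J-skew : ∀ i j → J i j ≈ - J j i
    J-skew zero       zero       = sym -0#≈0#
    J-skew zero       (suc zero) = sym (-‿involutive 1#)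
    J-skew (suc zero) zero       = refl
    J-skew (suc zero) (suc zero) = sym -0#≈0#

    K-diag : ∀ ν i → K ν i i ≈ 0#
    K-diag ν i with does (quotient {ν} 2 i Fin.≟ quotient {ν} 2 i)
    ... | true  = J-diag (remainder {ν} 2 i)
    ... | false = refl

    K-skew : ∀ ν i j → K ν i j ≈ - K ν j i
    K-skew ν i j with quotient {ν} 2 i Fin.≟ quotient {ν} 2 j
                    | quotient {ν} 2 j Fin.≟ quotient {ν} 2 i
    ... | yes _ | yes _ = J-skew (remainder {ν} 2 i) (remainder {ν} 2 j)
    ... | no  _ | no  _ = sym -0#≈0#
    ... | yes p | no ¬p = contradiction (≡.sym p) ¬p
    ... | no ¬p | yes p = contradiction (≡.sym p) ¬p

    term : ∀ ν (α β : Vector Carrier (ν ℕ.* 2)) → Matrix (ν ℕ.* 2)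
    term ν α β i j = α i * K ν i j * β j

    form≈ΣΣ : ∀ ν α β → form ν α β ≈ sum (λ i → sum (term ν α β i))
    form≈ΣΣ ν α β = trans
      (sum-cong-≋ λ j → *-distribʳ-sum (β j) (λ i → α i * K ν i j))
      (∑-comm (λ j i → term ν α β i j))

    term-skew : ∀ ν α β i j → term ν α β i j ≈ - term ν β α j i
    term-skew ν α β i j = begin
      α i * K ν i j * β j       ≈⟨ *-comm _ _ ⟩
      β j * (α i * K ν i j)     ≈⟨ *-congˡ (*-comm _ _) ⟩
      β j * (K ν i j * α i)     ≈⟨ *-assoc _ _ _ ⟨
      β j * K ν i j * α i       ≈⟨ *-congʳ (*-congˡ (K-skew ν i j)) ⟩
      β j * - K ν j i * α i     ≈⟨ *-congʳ (-‿distribʳ-* _ _) ⟨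
      - (β j * K ν j i) * α i   ≈⟨ -‿distribˡ-* _ _ ⟨
      - (β j * K ν j i * α i)   ∎

    form-skew : ∀ ν α β → form ν α β ≈ - form ν β α
    form-skew ν α β = begin
      form ν α β
        ≈⟨ sum-cong-≋ (λ j → *-distribʳ-sum (β j) (λ i → α i * K ν i j)) ⟩
      sum (λ j → sum λ i → term ν α β i j)
        ≈⟨ sum-cong-≋ (λ j → trans (sum-cong-≋ λ i → term-skew ν α β i j)
                                    (sum-neg (term ν β α j))) ⟩
      sum (λ j → - sum (term ν β α j))
        ≈⟨ sum-neg (λ j → sum (term ν β α j)) ⟩
      - sum (λ j → sum (term ν β α j))
        ≈⟨ -‿cong (form≈ΣΣ ν β α) ⟨
      - form ν β α ∎

    form-alternating : ∀ ν α → form ν α α ≈ 0#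
    form-alternating ν α = trans (form≈ΣΣ ν α α)
      (sum-alternating (term ν α α)
        (λ i → trans (*-congʳ (trans (*-congˡ (K-diag ν i)) (zeroʳ _)))
                     (zeroˡ _))
        (term-skew ν α α))

    form-scaleʳ : ∀ ν α β β′ a → β ≋ a · β′ → form ν α β ≈ a * form ν α β′
    form-scaleʳ ν α β β′ a β≋aβ′ = begin
      (γ ∙ β)
        ≈⟨ sum-cong-≋ (λ j → trans (*-congˡ (β≋aβ′ j)) (swap (γ j) (β′ j))) ⟩
      sum (λ j → a * (γ j * β′ j))   ≈⟨ *-distribˡ-sum a (λ j → γ j * β′ j) ⟨
      a * (γ ∙ β′)                   ∎
      where
      γ = α ʳ* K ν
      swap : ∀ x y → x * (a * y) ≈ a * (x * y)
      swap x y = trans (sym (*-assoc x a y))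
                   (trans (*-congʳ (*-comm x a)) (*-assoc a x y))

  module _ (ν : ℕ) where
    open Setoid (points (ν ℕ.* 2)) using ()
      renaming (Carrier to Point; _≈_ to _≈ₚ_)

    Adjacent : Rel Point ℓ₂
    Adjacent (α , _) (β , _) = form ν α β # 0#

    adjacent-sym : Symmetric Adjacent
    adjacent-sym {α , _} {β , _} αβ#0 =
      -x#0⇒x#0 (#-congʳ (form-skew ν α β) αβ#0)

    private
      respʳ : ∀ {α β β′} → β ≈ₚ β′ → Adjacent α β → Adjacent α β′
      respʳ {α , _} {β , _} {β′ , _} (β⊆β′ , _) αβ#0
        with β⊆β′ {β} (1# , λ i → sym (*-identityˡ (β i)))
      ... | a , β≋aβ′ =
        xy#0⇒y#0 (#-congʳ (form-scaleʳ ν α β β′ a β≋aβ′) αβ#0)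

    adjacent-resp-≈ : Adjacent Respects₂ _≈ₚ_
    adjacent-resp-≈ =
      (λ {x} {y} {z} → respʳ {x} {y} {z}) ,
      (λ {x} {y} {z} y≈z yx → adjacent-sym {x} {z}
        (respʳ {x} {y} {z} y≈z (adjacent-sym {y} {x} yx)))

    adjacent-irrefl : Irreflexive _≈ₚ_ Adjacent
    adjacent-irrefl {α , α≠0} {β , β≠0} α≈β αβ#0 =
      #-irrefl (form-alternating ν β)
        (proj₂ adjacent-resp-≈ {β , β≠0} {α , α≠0} {β , β≠0} α≈β αβ#0)

module _ {q : ℕ} (F : FiniteField q c ℓ₁ ℓ₂) where
  open FiniteField F
  open Symplectic heytingField
  private
    module size = Inverse size
    open CommutativeRing commutativeRing using (sym; trans; *-congʳ)

    _≟_ : Decidable _≈_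
    x ≟ y = map′ (λ e → trans (sym (size.inverseʳ ≡.refl)) (size.inverseʳ e))
                 size.to-cong (size.to x Fin.≟ size.to y)

    #0? : ∀ x → Dec (x # 0#)
    #0? x = map′ fwd bwd (Fin.any? λ i → (size.from i * (x - 0#)) ≟ 1#)
      where
      fwd : (∃[ i ] size.from i * (x - 0#) ≈ 1#) → x # 0#
      fwd (i , e) = invertibleˡ⇒# (size.from i , e)
      bwd : x # 0# → ∃[ i ] size.from i * (x - 0#) ≈ 1#
      bwd x#0 with #⇒invertible x#0
      ... | y , e , _ = size.to y , trans (*-congʳ (size.inverseʳ ≡.refl)) e

  Sp : ℕ → SimpleGraph (c ⊔ ℓ₂) (c ⊔ ℓ₁) ℓ₂
  Sp ν = record
    { vertices   = points (ν ℕ.* 2)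
    ; Adj        = Adjacent ν
    ; adj?       = λ (α , _) (β , _) → #0? (form ν α β)
    ; adj-resp-≈ = adjacent-resp-≈ ν
    ; adj-sym    = λ {x} {y} → adjacent-sym ν {x} {y}
    ; adj-irrefl = λ {x} {y} → adjacent-irrefl ν {x} {y}
    }

-- A point [β] adjacent to [α] has a unique representative on the affine
-- hyperplane α K ᵗβ = 1, so neighbours and common neighbours are unions of
-- fibres of surjective linear maps F^(2ν) → F and F^(2ν) → F², and every fibre
-- is a coset of the kernel; surjectivity is the nondegeneracy of K.  As λ = μ,
-- the adjacency matrix satisfies A² = ρ² I + μ J with ρ = q^(ν-1) and J the
-- all-ones matrix, and J x = 0 for an eigenvector x not belonging to the degree,
-- which leaves t² = ρ².  Cotransitivity of apartness from the distinct integers k, ρ, -ρ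
-- decides which value t takes.  For y = e_i - e_l the vectors (A ± ρ) y are
-- eigenvectors for ±ρ; (A + ρ) y is nonzero when i, l are not adjacent, and
-- (A - ρ) y is nonzero when they are.  For ν = 1 the graph is complete, and ρ
-- is not an eigenvalue.

module Submission where

open import Defs
open import Algebra.Apartness.Bundles using (HeytingField)
open import Data.Product using (_×_)
open import Data.Sum using (_⊎_)
open import Function.Bundles using (_⇔_)

open import Level using (Level)
open import Algebra.Bundles using (CommutativeRing)
import Algebra.Properties.Group as GroupProperties
import Algebra.Properties.Ring as RingProperties
import Algebra.Properties.Semiring.Mult as SemiringMult
import Algebra.Properties.Semiring.Sum as SemiringSum
import Algebra.Solver.Ring.NaturalCoefficients.Default as Solver
open import Data.Bool.Base using (if_then_else_)
open import Data.Fin.Base using (Fin; zero; suc; quotient; remainder; combine; opposite)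
open import Data.Fin.Permutation using (↔⇒≡)
import Data.Fin.Properties as Fin
open import Data.Nat.Base as ℕ using (ℕ; zero; suc)
import Data.Nat.DivMod as ℕ
import Data.Nat.Properties as ℕ
open import Data.Nat.Solver using (module +-*-Solver)
open import Data.Product.Base using (Σ; ∃₂; ∃-syntax; _,_; proj₁; proj₂)
open import Data.Product.Function.NonDependent.Setoid using (_×-inverse_)
open import Data.Product.Relation.Binary.Pointwise.NonDependent
  using (_×ₛ_; Pointwise-≡↔≡)
open import Data.Sum.Base as Sum using (inj₁; inj₂; [_,_]′)
open import Data.Sum.Function.Setoid using (_⊎-inverse_)
open import Data.Sum.Relation.Binary.Pointwise as ⊎ using (_⊎ₛ_; inj₁; inj₂)
open import Data.Vec.Functional using (Vector)
import Data.Vec.Functional.Relation.Binary.Equality.Setoid as VecEquality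
open import Function.Base using (_∘_; id)
open import Function.Bundles using (Inverse; mk⇔)
open import Function.Construct.Composition using () renaming (inverse to _∘-inverse_)
open import Function.Construct.Symmetry using () renaming (inverse to inverse-sym)
open import Relation.Binary.Bundles using (Setoid)
open import Relation.Binary.Definitions as B using (_Respects_)
open import Relation.Binary.PropositionalEquality.Core as ≡ using (_≡_; _≢_)
import Relation.Binary.PropositionalEquality.Properties as ≡
import Relation.Binary.Reasoning.Setoid as ≈-Reasoning
open import Relation.Nullary.Decidable using (Dec; yes; no; does; map′; _×-dec_)
open import Relation.Nullary.Negation.Core using (¬_; contradiction)
open import Relation.Unary using (Pred; Decidable; _≐_)

private
  variable
    a b c d ℓ p q r : Level
    m n : ℕ

-- Sizes of setoids

module _ {S : Setoid a b} {T : Setoid c d} where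
  private
    module S = Setoid S
    module T = Setoid T

  mk-inverse : (to : S.Carrier → T.Carrier) (from : T.Carrier → S.Carrier) →
               (∀ {x y} → x S.≈ y → to x T.≈ to y) →
               (∀ {x y} → x T.≈ y → from x S.≈ from y) →
               (∀ y → to (from y) T.≈ y) → (∀ x → from (to x) S.≈ x) →
               Inverse S T
  mk-inverse to from to-cong from-cong to∘from from∘to = record
    { to = to ; from = from ; to-cong = to-cong ; from-cong = from-cong
    ; inverse = (λ e → T.trans (to-cong e) (to∘from _))
              , (λ e → S.trans (from-cong e) (from∘to _)) }

size-via : {S : Setoid a b} {T : Setoid c d} →
           Inverse S T → HasSize T n → HasSize S n
size-via = _∘-inverse_

-- Composing the two enumerations gives a bijection between finite ordinals. Double counting rests
-- on this: enumerating one setoid in two ways yields an equation of numbers.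
size-unique : {S : Setoid a b} → HasSize S m → HasSize S n → m ≡ n
size-unique i j = ↔⇒≡ (inverse-sym i ∘-inverse j)

size-× : {S : Setoid a b} {T : Setoid c d} →
         HasSize S m → HasSize T n → HasSize (S ×ₛ T) (m ℕ.* n)
size-× i j =
  (i ×-inverse j) ∘-inverse (Pointwise-≡↔≡ ∘-inverse inverse-sym Fin.*↔×)

size-⊎ : {S : Setoid a b} {T : Setoid c d} →
         HasSize S m → HasSize T n → HasSize (S ⊎ₛ T) (m ℕ.+ n)
size-⊎ i j =
  (i ⊎-inverse j) ∘-inverse (⊎.Pointwise-≡↔≡ _ _ ∘-inverse inverse-sym Fin.+↔⊎)

size-singleton : {S : Setoid a b} (x : Setoid.Carrier S) →
                 (∀ y → Setoid._≈_ S x y) → HasSize S 1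
size-singleton {S = S} x x≈ = mk-inverse (λ _ → zero) (λ _ → x)
  (λ _ → ≡.refl) (λ _ → Setoid.refl S) (λ { zero → ≡.refl }) x≈

size-empty : {S : Setoid a b} → ¬ Setoid.Carrier S → HasSize S 0
size-empty ¬S = mk-inverse (λ x → contradiction x ¬S) (λ ())
  (λ {x} _ → contradiction x ¬S) (λ { {()} }) (λ ()) (λ x → contradiction x ¬S)

count : {P : Pred (Fin n) r} → Decidable P → ℕ
count {zero}  P? = 0
count {suc n} P? = (if does (P? zero) then suc else id) (count (P? ∘ suc))

size-count : {P : Pred (Fin n) r} (P? : Decidable P) →
             HasSize (Restrict (≡.setoid (Fin n)) P) (count P?)
size-count {zero}  P? = size-empty λ ()
size-count {suc n} {P = P} P? with P? zero | size-count (P? ∘ suc)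
... | yes p | ih = mk-inverse to from to-cong (λ { ≡.refl → ≡.refl })
  (λ { zero → ≡.refl ; (suc k) → ≡.cong suc (ih.inverseˡ {y = ih.from k} ≡.refl) })
  (λ { (zero , _) → ≡.refl ; (suc i , p) → ≡.cong suc (ih.inverseʳ {i , p} ≡.refl) })
  where
  module ih = Inverse ih
  to : Σ (Fin (suc n)) P → Fin (suc (count (P? ∘ suc)))
  to (zero  , _) = zero
  to (suc i , p) = suc (ih.to (i , p))
  from : Fin (suc (count (P? ∘ suc))) → Σ (Fin (suc n)) P
  from zero    = zero , p
  from (suc k) = suc (proj₁ (ih.from k)) , proj₂ (ih.from k)
  -- Equality in `Restrict` ignores the proofs of `P`, so `x` and `y` may carry different ones.
  to-cong : ∀ {x y} → proj₁ x ≡ proj₁ y → to x ≡ to y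
  to-cong {zero  , _} {zero  , _} _ = ≡.refl
  to-cong {suc i , _} {suc j , _} e = ≡.cong suc (ih.to-cong (Fin.suc-injective e))
... | no ¬p | ih = mk-inverse to from to-cong (λ { ≡.refl → ≡.refl })
  (λ k → ih.inverseˡ {y = ih.from k} ≡.refl)
  (λ { (zero , p) → contradiction p ¬p
     ; (suc i , p) → ≡.cong suc (ih.inverseʳ {i , p} ≡.refl) })
  where
  module ih = Inverse ih
  to : Σ (Fin (suc n)) P → Fin (count (P? ∘ suc))
  to (zero  , p) = contradiction p ¬p
  to (suc i , p) = ih.to (i , p)
  from : Fin (count (P? ∘ suc)) → Σ (Fin (suc n)) P
  from k = suc (proj₁ (ih.from k)) , proj₂ (ih.from k)
  to-cong : ∀ {x y} → proj₁ x ≡ proj₁ y → to x ≡ to y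
  to-cong {zero  , p} _ = contradiction p ¬p
  to-cong {suc i , _} {suc j , _} e = ih.to-cong (Fin.suc-injective e)

Restrict-cong : (S : Setoid a b) {P : Pred (Setoid.Carrier S) p}
                {Q : Pred (Setoid.Carrier S) q} →
                (∀ {x} → P x → Q x) → (∀ {x} → Q x → P x) →
                Inverse (Restrict S P) (Restrict S Q)
Restrict-cong S P⇒Q Q⇒P = mk-inverse
  (λ (x , p) → x , P⇒Q p) (λ (x , q) → x , Q⇒P q) id id
  (λ _ → S.refl) (λ _ → S.refl)
  where module S = Setoid S

Restrict-all : (S : Setoid a b) {P : Pred (Setoid.Carrier S) r} →
               (∀ x → P x) → Inverse (Restrict S P) S
Restrict-all S p = mk-inverse proj₁ (λ x → x , p x) id id
  (λ _ → Setoid.refl S) (λ _ → Setoid.refl S)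

module _ {S : Setoid a b} (enum : HasSize S n) where
  open Setoid S
  private module enum = Inverse enum

  enum-≟ : B.Decidable _≈_
  enum-≟ x y = map′ (λ e → trans (sym (enum.inverseʳ ≡.refl)) (enum.inverseʳ e))
                    enum.to-cong (enum.to x Fin.≟ enum.to y)

  Restrict-enum : {P : Pred Carrier r} → P Respects _≈_ →
                  Inverse (Restrict S P)
                          (Restrict (≡.setoid (Fin n)) (P ∘ enum.from))
  Restrict-enum resp = mk-inverse
    (λ (x , p) → enum.to x , resp (sym (enum.inverseʳ ≡.refl)) p)
    (λ (i , p) → enum.from i , p)
    enum.to-cong enum.from-cong
    (λ _ → enum.inverseˡ refl) (λ _ → enum.inverseʳ ≡.refl)

  size-restrict : {P : Pred Carrier r} → P Respects _≈_ → (P? : Decidable P) →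
                  HasSize (Restrict S P) (count (P? ∘ enum.from))
  size-restrict resp P? = size-via (Restrict-enum resp) (size-count (P? ∘ enum.from))

module _ (S : Setoid a b) where
  open Setoid S

  -- Disjointness is demanded up to `_≈_`; this makes the side chosen by `cover` independent of the
  -- representative, so that the splitting respects equality.
  Restrict-⊎ : {P : Pred Carrier p} {Q : Pred Carrier q} →
               (∀ x → P x ⊎ Q x) → (∀ {x y} → x ≈ y → P x → ¬ Q y) →
               Inverse S (Restrict S P ⊎ₛ Restrict S Q)
  Restrict-⊎ {P = P} {Q} cover disjoint = mk-inverse
    (λ x → split (cover x)) from split-cong
    (λ { (inj₁ e) → e ; (inj₂ e) → e })
    to∘from (λ x → from∘split (cover x))
    where
    split : ∀ {x} → P x ⊎ Q x → Σ Carrier P ⊎ Σ Carrier Q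
    split = Sum.map (_ ,_) (_ ,_)
    from : Σ Carrier P ⊎ Σ Carrier Q → Carrier
    from = [ proj₁ , proj₁ ]′
    _≈′_ = Setoid._≈_ (Restrict S P ⊎ₛ Restrict S Q)
    split-cong : ∀ {x y} → x ≈ y → split (cover x) ≈′ split (cover y)
    split-cong {x} {y} e with cover x | cover y
    ... | inj₁ _ | inj₁ _ = inj₁ e
    ... | inj₂ _ | inj₂ _ = inj₂ e
    ... | inj₁ p | inj₂ q = contradiction q (disjoint e p)
    ... | inj₂ q | inj₁ p = contradiction q (disjoint (sym e) p)
    from∘split : ∀ {x} (c : P x ⊎ Q x) → from (split c) ≈ x
    from∘split (inj₁ _) = refl
    from∘split (inj₂ _) = refl
    to∘from : ∀ z → split (cover (from z)) ≈′ z
    to∘from (inj₁ (x , p)) with cover x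
    ... | inj₁ _ = inj₁ refl
    ... | inj₂ q = contradiction q (disjoint refl p)
    to∘from (inj₂ (x , q)) with cover x
    ... | inj₁ p = contradiction q (disjoint refl p)
    ... | inj₂ _ = inj₂ refl

-- Linear algebra over Heyting fields

module HeytingLinear (F : HeytingField c ℓ r) where
  open LinearAlgebra F public
  open CommutativeRing commutativeRing public
    using ( refl; sym; trans; +-cong; +-congˡ; +-congʳ; +-identityˡ; +-identityʳ
          ; *-congˡ; *-congʳ; *-assoc; *-comm; *-identityˡ; *-identityʳ
          ; -‿cong; -‿inverseʳ; -‿inverseˡ; zeroˡ; zeroʳ; distribˡ; distribʳ
          ; +-assoc; +-comm; commutativeSemiring; +-group; reflexive)
  open RingProperties ring public
    using (-‿distribˡ-*; -‿distribʳ-*; -‿involutive; -0#≈0#; -1*x≈-x)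
  open GroupProperties +-group public
    using () renaming (x∙y⁻¹≈ε⇒x≈y to x-y≈0⇒x≈y; x≈y⇒x∙y⁻¹≈ε to x≈y⇒x-y≈0)
  open SemiringSum semiring public
    using ( sum-cong-≋; ∑-comm; ∑-distrib-+; *-distribˡ-sum; *-distribʳ-sum
          ; sum-replicate-zero)
  open HeytingField F public using (tight; #-cotrans; #-sym)
  open Solver commutativeSemiring public using (solve; _:+_; _:*_; _:=_)
  open ≈-Reasoning setoid public

  #-inverse : ∀ {x} → x # 0# → ∃[ y ] y * x ≈ 1#
  #-inverse {x} x#0 with #⇒invertible x#0
  ... | y , y*x≈1 , _ = y , trans (*-congˡ (sym (x-0≈x x))) y*x≈1

  inverse⇒#0 : ∀ {x y} → y * x ≈ 1# → x # 0#
  inverse⇒#0 {x} {y} yx≈1 = invertibleˡ⇒# (y , trans (*-congˡ (x-0≈x x)) yx≈1)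

  ≈1⇒#0 : ∀ {x} → x ≈ 1# → x # 0#
  ≈1⇒#0 x≈1 = #-congʳ (sym x≈1) 1#0

  ≈0⇒¬#0 : ∀ {x} → x ≈ 0# → ¬ x # 0#
  ≈0⇒¬#0 x≈0 = proj₂ (tight _ _) x≈0

  *-#0ʳ : ∀ {x y} → x * y # 0# → y # 0#
  *-#0ʳ {x} {y} xy#0 with #-inverse xy#0
  ... | z , e = inverse⇒#0 (trans (*-assoc z x y) e)

  *-#0ˡ : ∀ {x y} → x * y # 0# → x # 0#
  *-#0ˡ {x} {y} xy#0 = *-#0ʳ (#-congʳ (*-comm x y) xy#0)

  *-cancelˡ-0 : ∀ {x y} → x # 0# → x * y ≈ 0# → y ≈ 0#
  *-cancelˡ-0 {x} {y} x#0 xy≈0 with #-inverse x#0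
  ... | z , zx≈1 = begin
    y           ≈⟨ *-identityˡ y ⟨
    1# * y      ≈⟨ *-congʳ zx≈1 ⟨
    z * x * y   ≈⟨ *-assoc z x y ⟩
    z * (x * y) ≈⟨ *-congˡ xy≈0 ⟩
    z * 0#      ≈⟨ zeroʳ z ⟩
    0#          ∎

  #⇒-#0 : ∀ {x y} → x # y → x - y # 0#
  #⇒-#0 x#y with #⇒invertible x#y
  ... | z , e , _ = inverse⇒#0 e

  -#0⇒# : ∀ {x y} → x - y # 0# → x # y
  -#0⇒# x-y#0 with #-inverse x-y#0
  ... | z , e = invertibleˡ⇒# (z , e)

  -- The difference `x - y` is invertible and annihilates `z`.
  #∧*≈⇒≈0 : ∀ {x y z} → x # y → x * z ≈ y * z → z ≈ 0#
  #∧*≈⇒≈0 {x} {y} {z} x#y xz≈yz = *-cancelˡ-0 (#⇒-#0 x#y) (begin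
    (x - y) * z       ≈⟨ distribʳ z x (- y) ⟩
    x * z + - y * z   ≈⟨ +-congˡ (-‿distribˡ-* y z) ⟨
    x * z - y * z     ≈⟨ x≈y⇒x-y≈0 xz≈yz ⟩
    0#                ∎)

  sum-zero : ∀ {n} {f : Vector Carrier n} → (∀ i → f i ≈ 0#) → sum f ≈ 0#
  sum-zero {n} f≈0 = trans (sum-cong-≋ f≈0) (sum-replicate-zero n)

  sum-single : ∀ {n} (f : Vector Carrier n) i → (∀ j → j ≢ i → f j ≈ 0#) →
               sum f ≈ f i
  sum-single f zero f≈0 =
    trans (+-congˡ (sum-zero λ j → f≈0 (suc j) λ ())) (+-identityʳ _)
  sum-single f (suc i) f≈0 = trans
    (+-cong (f≈0 zero λ ()) (sum-single (f ∘ suc) i λ j j≢i →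
      f≈0 (suc j) (j≢i ∘ Fin.suc-injective)))
    (+-identityˡ _)

  infixl 6 _+ᵛ_
  _+ᵛ_ : ∀ {n} → Vector Carrier n → Vector Carrier n → Vector Carrier n
  (x +ᵛ y) i = x i + y i

  δ : ∀ {n} → Matrix n
  δ i j = if does (i Fin.≟ j) then 1# else 0#

  δ-refl : ∀ {n} (i : Fin n) → δ i i ≈ 1#
  δ-refl i with i Fin.≟ i
  ... | yes _ = refl
  ... | no ¬p = contradiction ≡.refl ¬p

  δ-≢ : ∀ {n} {i j : Fin n} → i ≢ j → δ i j ≈ 0#
  δ-≢ {i = i} {j} i≢j with i Fin.≟ j
  ... | yes p = contradiction p i≢j
  ... | no _  = refl

  ∙-δ : ∀ {n} (x : Vector Carrier n) i → x ∙ δ i ≈ x i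
  ∙-δ x i = trans
    (sum-single _ i λ j j≢i → trans (*-congˡ (δ-≢ (j≢i ∘ ≡.sym))) (zeroʳ _))
    (trans (*-congˡ (δ-refl i)) (*-identityʳ _))

  ∙-cong : ∀ {n} (x : Vector Carrier n) {y z} → y ≋ z → x ∙ y ≈ x ∙ z
  ∙-cong x y≋z = sum-cong-≋ λ i → *-congˡ (y≋z i)

  ∙-distribˡ-+ : ∀ {n} (x y z : Vector Carrier n) →
                 x ∙ (y +ᵛ z) ≈ x ∙ y + x ∙ z
  ∙-distribˡ-+ x y z =
    trans (sum-cong-≋ λ i → distribˡ (x i) (y i) (z i))
          (∑-distrib-+ (λ i → x i * y i) (λ i → x i * z i))

  ∙-scaleʳ : ∀ {n} (x : Vector Carrier n) a y → x ∙ (a · y) ≈ a * (x ∙ y)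
  ∙-scaleʳ x a y = trans
    (sum-cong-≋ λ i →
      solve 3 (λ x a y → x :* (a :* y) := a :* (x :* y)) refl (x i) a (y i))
    (sym (*-distribˡ-sum a (λ i → x i * y i)))

  ∙-axpy : ∀ {n} (γ x y : Vector Carrier n) a →
           γ ∙ (x +ᵛ a · y) ≈ γ ∙ x + a * (γ ∙ y)
  ∙-axpy γ x y a = trans (∙-distribˡ-+ γ x (a · y)) (+-congˡ (∙-scaleʳ γ a y))

-- The symplectic graph

module FiniteLinear {q} (F : FiniteField q c ℓ r) where
  open FiniteField F using (heytingField; size)
  open HeytingLinear heytingField public
  open VecEquality setoid using (≋-setoid)

  private
    module size = Inverse size

  -- An inverse is searched among the finitely many elements. If none exists then `x` is not apart
  -- from 0, and tightness makes it equal to 0.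
  zero? : ∀ x → x ≈ 0# ⊎ x # 0#
  zero? x with Fin.any? (λ i → enum-≟ size (size.from i * x) 1#)
  ... | yes (i , e) = inj₂ (inverse⇒#0 e)
  ... | no ∄x⁻¹     = inj₁ (proj₁ (tight x 0#) λ x#0 →
    let y , yx≈1 = #-inverse x#0 in
    ∄x⁻¹ (size.to y , trans (*-congʳ (size.inverseʳ ≡.refl)) yx≈1))

  nonZero? : ∀ {n} (x : Vector Carrier n) → (∀ i → x i ≈ 0#) ⊎ NonZeroVector x
  nonZero? {zero}  x = inj₁ λ ()
  nonZero? {suc n} x with zero? (x zero) | nonZero? (x ∘ suc)
  ... | inj₂ x₀#0 | _              = inj₂ (zero , x₀#0)
  ... | inj₁ x₀≈0 | inj₂ (i , xᵢ#0) = inj₂ (suc i , xᵢ#0)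
  ... | inj₁ x₀≈0 | inj₁ x≈0       = inj₁ λ { zero → x₀≈0 ; (suc i) → x≈0 i }

  0<q : 0 ℕ.< q
  0<q = ℕ.≤-trans (ℕ.s≤s ℕ.z≤n) (Fin.toℕ<n (size.to 0#))

  -- The field is the disjoint union of the singleton 0 and the units, so one plus the number of
  -- units is `q`.
  size-units : HasSize (Restrict setoid (_# 0#)) (q ℕ.∸ 1)
  size-units = ≡.subst (HasSize _) (≡.cong (ℕ._∸ 1) q≡) units
    where
    Unit : Carrier → Set r
    Unit x = x # 0#
    unit? : Decidable Unit
    unit? x with zero? x
    ... | inj₁ x≈0 = no (≈0⇒¬#0 x≈0)
    ... | inj₂ x#0 = yes x#0
    units = size-restrict size {P = Unit} #-congʳ unit?
    q≡ : suc (count (unit? ∘ size.from)) ≡ q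
    q≡ = size-unique
      (size-via (Restrict-⊎ setoid zero? λ x≈y x≈0 →
                  ≈0⇒¬#0 (trans (sym x≈y) x≈0))
        (size-⊎ (size-singleton (0# , refl) (sym ∘ proj₂)) units))
      size

  size-vectors : ∀ n → HasSize (≋-setoid n) (q ℕ.^ n)
  size-vectors zero    = size-singleton (λ ()) (λ _ ())
  size-vectors (suc n) = size-via
    (mk-inverse {T = setoid ×ₛ ≋-setoid n}
      (λ x → x zero , x ∘ suc)
      (λ { (a , x) zero → a ; (a , x) (suc i) → x i })
      (λ x≋y → x≋y zero , x≋y ∘ suc)
      (λ { (e , _) zero → e ; (_ , e) (suc i) → e i })
      (λ _ → refl , λ _ → refl)
      (λ { _ zero → refl ; _ (suc i) → refl }))
    (size-× size (size-vectors n))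

  module Fibres {n k} (Γ : Fin k → Vector Carrier n)
                (section : Vector Carrier k → Vector Carrier n)
                (section-cong : ∀ {x y} → x ≋ y → section x ≋ section y) where

    Φ : Vector Carrier n → Vector Carrier k
    Φ x i = Γ i ∙ x

    Kernel : Pred (Vector Carrier n) ℓ
    Kernel x = ∀ i → Φ x i ≈ 0#

    module _ (Φ∘section : ∀ x → Φ (section x) ≋ x) where

      -- Each `x` is the sum of `x - section (Φ x)`, which lies in the kernel, and the chosen
      -- preimage `section (Φ x)` of its value. Every fibre is thus a translate of the kernel.
      fibres : {Q : Pred (Vector Carrier k) p} → Q Respects _≋_ →
               Inverse (Restrict (≋-setoid n) (Q ∘ Φ))
                       (Restrict (≋-setoid n) Kernel ×ₛ Restrict (≋-setoid k) Q)
      fibres {Q = Q} resp = mk-inverse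
        (λ (x , p) → (project x , project-kernel x) , (Φ x , p))
        (λ ((w , w∈) , (a , p)) → w +ᵛ section a ,
          resp (λ i → sym (Φ-fibre w∈ a i)) p)
        (λ x≋y → project-cong x≋y , Φ-cong x≋y)
        (λ (e , e′) i → +-cong (e i) (section-cong e′ i))
        (λ ((w , w∈) , (a , p)) →
          (λ i → begin
            w i + section a i + - 1# * section (Φ (w +ᵛ section a)) i
              ≈⟨ +-congˡ (trans (*-congˡ (section-cong (Φ-fibre w∈ a) i)) (-1*x≈-x _)) ⟩
            w i + section a i - section a i   ≈⟨ +-assoc _ _ _ ⟩
            w i + (section a i - section a i) ≈⟨ +-congˡ (-‿inverseʳ _) ⟩
            w i + 0#                          ≈⟨ +-identityʳ _ ⟩
            w i                               ∎)
          , Φ-fibre w∈ a)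
        (λ (x , p) i → begin
          x i + - 1# * section (Φ x) i + section (Φ x) i
            ≈⟨ +-congʳ (+-congˡ (-1*x≈-x _)) ⟩
          x i - section (Φ x) i + section (Φ x) i     ≈⟨ +-assoc _ _ _ ⟩
          x i + (- section (Φ x) i + section (Φ x) i) ≈⟨ +-congˡ (-‿inverseˡ _) ⟩
          x i + 0#                                    ≈⟨ +-identityʳ _ ⟩
          x i                                         ∎)
        where
        Φ-cong : ∀ {x y} → x ≋ y → Φ x ≋ Φ y
        Φ-cong x≋y i = ∙-cong (Γ i) x≋y
        project : Vector Carrier n → Vector Carrier n
        project x = x +ᵛ (- 1#) · section (Φ x)
        project-cong : ∀ {x y} → x ≋ y → project x ≋ project y
        project-cong x≋y i = +-cong (x≋y i) (*-congˡ (section-cong (Φ-cong x≋y) i))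
        project-kernel : ∀ x → Kernel (project x)
        project-kernel x i = begin
          Γ i ∙ project x                           ≈⟨ ∙-distribˡ-+ (Γ i) _ _ ⟩
          Φ x i + Γ i ∙ ((- 1#) · section (Φ x))    ≈⟨ +-congˡ (∙-scaleʳ (Γ i) _ _) ⟩
          Φ x i + - 1# * Φ (section (Φ x)) i        ≈⟨ +-congˡ (-1*x≈-x _) ⟩
          Φ x i - Φ (section (Φ x)) i               ≈⟨ x≈y⇒x-y≈0 (sym (Φ∘section (Φ x) i)) ⟩
          0#                                        ∎
        Φ-fibre : ∀ {w} → Kernel w → ∀ a → Φ (w +ᵛ section a) ≋ a
        Φ-fibre {w} w∈ a i = begin
          Γ i ∙ (w +ᵛ section a)      ≈⟨ ∙-distribˡ-+ (Γ i) w _ ⟩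
          Φ w i + Φ (section a) i     ≈⟨ +-cong (w∈ i) (Φ∘section a i) ⟩
          0# + a i                    ≈⟨ +-identityˡ _ ⟩
          a i                         ∎

      -- Only the kernel size `w` has to be found. Taking all of `F^k` for `Q` makes the fibres
      -- exhaust `F^n`, so `w * q^k` equals `q^n`, and `q^k` cancels.
      size-fibres : k ℕ.≤ n → {Q : Pred (Vector Carrier k) p} → Q Respects _≋_ →
                    HasSize (Restrict (≋-setoid k) Q) m →
                    HasSize (Restrict (≋-setoid n) (Q ∘ Φ)) (q ℕ.^ (n ℕ.∸ k) ℕ.* m)
      size-fibres {m = m} k≤n resp sizeQ =
        size-via (fibres resp) (size-× (≡.subst (HasSize _) w≡ size-kernel) sizeQ)
        where
        kernel? : Decidable Kernel
        kernel? x = Fin.all? λ i → enum-≟ size (Φ x i) 0#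
        size-kernel = size-restrict (size-vectors n) {P = Kernel}
          (λ x≋y x∈ i → trans (∙-cong (Γ i) (λ j → sym (x≋y j))) (x∈ i)) kernel?
        w = count (kernel? ∘ Inverse.from (size-vectors n))
        everything : Pred (Vector Carrier k) ℓ
        everything _ = 0# ≈ 0#
        w*qᵏ≡qⁿ : w ℕ.* q ℕ.^ k ≡ q ℕ.^ n
        w*qᵏ≡qⁿ = size-unique
          (size-× size-kernel
                  (size-via (Restrict-all _ {everything} λ _ → refl) (size-vectors k)))
          (size-via (inverse-sym (fibres {Q = everything} λ _ _ → refl))
                    (size-via (Restrict-all _ λ _ → refl) (size-vectors n)))
        instance
          _ = ℕ.>-nonZero 0<q
        w≡ : w ≡ q ℕ.^ (n ℕ.∸ k)
        w≡ = ℕ.*-cancelʳ-≡ w (q ℕ.^ (n ℕ.∸ k)) (q ℕ.^ k) {{ℕ.m^n≢0 q k}}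
          (≡.trans w*qᵏ≡qⁿ
            (≡.trans (≡.cong (q ℕ.^_) (≡.sym (ℕ.m∸n+n≡m k≤n)))
                     (ℕ.^-distribˡ-+-* q (n ℕ.∸ k) k)))

  -- Points of projective space and their normalised representatives

  open Symplectic heytingField using (points; J; K)

  -- A nonzero entry of `x` is a multiple of `a`, which forces `a` to be invertible, so each vector
  -- is a multiple of the other.
  proportional⇒≐ : ∀ {n} (x y : Vector Carrier n) a → NonZeroVector x →
                   x ≋ a · y → Span x ≐ Span y
  proportional⇒≐ α β a (i , αᵢ#0) α≋aβ with
    #-inverse (*-#0ˡ (#-congʳ (α≋aβ i) αᵢ#0))
  ... | a⁻¹ , a⁻¹a≈1 =
    (λ (b , e) → b * a , λ j →
      trans (e j) (trans (*-congˡ (α≋aβ j)) (sym (*-assoc _ _ _)))) ,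
    (λ (b , e) → b * a⁻¹ , λ j → trans (e j) (begin
      b * β j               ≈⟨ *-congˡ (*-identityˡ _) ⟨
      b * (1# * β j)        ≈⟨ *-congˡ (*-congʳ a⁻¹a≈1) ⟨
      b * (a⁻¹ * a * β j)   ≈⟨ solve 4 (λ b a⁻¹ a x → b :* (a⁻¹ :* a :* x) := b :* a⁻¹ :* (a :* x))
                                 refl b a⁻¹ a (β j) ⟩
      b * a⁻¹ * (a * β j)   ≈⟨ *-congˡ (α≋aβ j) ⟨
      b * a⁻¹ * α j         ∎))

  ≐⇒proportional : ∀ {n} (x y : Vector Carrier n) → Span x ≐ Span y →
                   ∃[ a ] x ≋ a · y
  ≐⇒proportional x y (x⊆y , _) = x⊆y (1# , λ i → sym (*-identityˡ _))

  module Normalise {n} {φ : Vector Carrier n → Carrier}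
                   (φ-homo : ∀ {x y} a → x ≋ a · y → φ x ≈ a * φ y) where

    private
      φ#0⇒nonZero : ∀ x → φ x # 0# → NonZeroVector x
      φ#0⇒nonZero x φx#0 with nonZero? x
      ... | inj₂ x≠0 = x≠0
      ... | inj₁ x≈0 = contradiction φx#0
        (≈0⇒¬#0 (trans (φ-homo {y = x} 0# λ i → trans (x≈0 i) (sym (zeroˡ _))) (zeroˡ _)))

      normalised-unique : ∀ {x y} a → x ≋ a · y → φ x ≈ 1# → φ y ≈ 1# → x ≋ y
      normalised-unique {x} {y} a x≋ay φx≈1 φy≈1 i = begin
        x i       ≈⟨ x≋ay i ⟩
        a * y i   ≈⟨ *-congʳ a≈1 ⟩
        1# * y i  ≈⟨ *-identityˡ _ ⟩
        y i       ∎
        where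
        a≈1 : a ≈ 1#
        a≈1 = begin
          a         ≈⟨ *-identityʳ a ⟨
          a * 1#    ≈⟨ *-congˡ φy≈1 ⟨
          a * φ y   ≈⟨ φ-homo a x≋ay ⟨
          φ x       ≈⟨ φx≈1 ⟩
          1#        ∎

    -- Dividing by the value of `φ` picks the unique representative on the hyperplane where `φ` is
    -- 1. Points, which are classes of vectors, can then be counted as plain vectors.
    normalise : {P : Pred (Vector Carrier n) p} →
                (∀ {x y} a → a # 0# → x ≋ a · y → P y → P x) →
                (∀ {x} → P x → φ x # 0#) →
                Inverse (Restrict (points n) (P ∘ proj₁))
                        (Restrict (≋-setoid n) λ x → φ x ≈ 1# × P x)
    normalise {P = P} P-scale P⇒φ#0 = mk-inverse
      (λ ((α , _) , p) → let u , e = #-inverse (P⇒φ#0 p) in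
        u · α , φ-normal p , P-scale u (u#0 p) (λ _ → refl) p)
      (λ (x , e , p) → (x , φ#0⇒nonZero x (≈1⇒#0 e)) , p)
      (λ {((α , _) , p)} {((β , _) , p′)} α≈β →
        let a , α≋aβ = ≐⇒proportional α β α≈β
            u , _     = #-inverse (P⇒φ#0 p)
            v , vφβ≈1 = #-inverse (P⇒φ#0 p′)
        -- With `u` and `v` inverse to `φ α` and `φ β`, this coefficient carries `v · β` to `u · α`.
        -- Both vectors have value 1 under `φ`, so it must equal 1.
        in normalised-unique (u * a * φ β) (λ i → begin
          u * α i                          ≈⟨ *-congˡ (α≋aβ i) ⟩
          u * (a * β i)                    ≈⟨ *-identityˡ _ ⟨
          1# * (u * (a * β i))             ≈⟨ *-congʳ vφβ≈1 ⟨
          v * φ β * (u * (a * β i))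
            ≈⟨ solve 5 (λ v p u a b → v :* p :* (u :* (a :* b)) := u :* a :* p :* (v :* b))
                 refl v (φ β) u a (β i) ⟩
          u * a * φ β * (v * β i)          ∎)
          (φ-normal p) (φ-normal p′))
      (λ {(x , e , _)} {(y , e′ , _)} x≋y →
        proportional⇒≐ x y 1# (φ#0⇒nonZero x (≈1⇒#0 e))
          λ i → trans (x≋y i) (sym (*-identityˡ _)))
      (λ (x , e , p) → normalised-unique _ (λ _ → refl) (φ-normal p) e)
      (λ ((α , _) , p) → proportional⇒≐ _ α (proj₁ (#-inverse (P⇒φ#0 p)))
        (φ#0⇒nonZero _ (≈1⇒#0 (φ-normal p))) (λ _ → refl))
      where
      φ-normal : ∀ {x} (p : P x) → φ (proj₁ (#-inverse (P⇒φ#0 p)) · x) ≈ 1#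
      φ-normal p = trans (φ-homo _ λ _ → refl) (proj₂ (#-inverse (P⇒φ#0 p)))
      u#0 : ∀ {x} (p : P x) → proj₁ (#-inverse (P⇒φ#0 p)) # 0#
      u#0 p = *-#0ˡ (≈1⇒#0 (proj₂ (#-inverse (P⇒φ#0 p))))

  -- Points with nonzero first coordinate form an affine space; the others
  -- form a projective space of one dimension less.
  pointCount : ℕ → ℕ
  pointCount zero    = 0
  pointCount (suc n) = q ℕ.^ n ℕ.+ pointCount n

  size-points : ∀ n → HasSize (points n) (pointCount n)
  size-points zero    = size-empty λ ()
  size-points (suc n) = size-via
    (Restrict-⊎ (points (suc n)) {P = λ (α , _) → α zero # 0#} {Q = λ (α , _) → α zero ≈ 0#}
      (λ (α , _) → Sum.swap (zero? (α zero)))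
      (λ {(α , _)} {(β , _)} α≈β α₀#0 β₀≈0 → ≈0⇒¬#0
        (let a , α≋aβ = ≐⇒proportional α β α≈β in
         trans (α≋aβ zero) (trans (*-congˡ β₀≈0) (zeroʳ a))) α₀#0))
    (size-⊎ (size-via affine (size-vectors n)) (size-via atInfinity (size-points n)))
    where
    open Normalise {suc n} {λ x → x zero} (λ _ e → e zero)
    -- Once the first coordinate is scaled to 1, the remaining `n` coordinates are free.
    affine : Inverse (Restrict (points (suc n)) λ (α , _) → α zero # 0#) (≋-setoid n)
    affine = normalise {P = λ x → x zero # 0#}
        (λ a a#0 e y₀#0 → #-congʳ (sym (e zero)) (x#0y#0→xy#0 a#0 y₀#0)) id
      ∘-inverse mk-inverse
        (λ (x , _) → x ∘ suc)
        (λ y → (λ { zero → 1# ; (suc i) → y i }) , refl , 1#0)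
        (_∘ suc)
        (λ { e zero → refl ; e (suc i) → e i })
        (λ _ _ → refl)
        (λ { (x , e , _) zero → sym e ; (x , e , _) (suc i) → refl })
    atInfinity : Inverse (Restrict (points (suc n)) λ (α , _) → α zero ≈ 0#) (points n)
    atInfinity = mk-inverse
      (λ ((α , α≠0) , α₀≈0) → α ∘ suc , tail≠0 α₀≈0 α≠0)
      (λ (β , i , βᵢ#0) → (0∷ β , suc i , βᵢ#0) , refl)
      (λ {((α , α≠0) , α₀≈0)} {((β , _) , _)} α≈β →
        let a , e = ≐⇒proportional α β α≈β in
        proportional⇒≐ _ _ a (tail≠0 α₀≈0 α≠0) (e ∘ suc))
      (λ {(α , i , αᵢ#0)} {(β , _)} α≈β → let a , e = ≐⇒proportional α β α≈β in
        proportional⇒≐ (0∷ α) (0∷ β) a (suc i , αᵢ#0) λ { zero → sym (zeroʳ a) ; (suc i) → e i })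
      (λ _ → id , id)
      (λ ((α , α≠0) , α₀≈0) → let i , αᵢ#0 = tail≠0 α₀≈0 α≠0 in
        proportional⇒≐ (0∷ (α ∘ suc)) α 1# (suc i , αᵢ#0)
          λ { zero → trans (sym α₀≈0) (sym (*-identityˡ _)) ; (suc i) → sym (*-identityˡ _) })
      where
      0∷_ : Vector Carrier n → Vector Carrier (suc n)
      (0∷ x) zero    = 0#
      (0∷ x) (suc i) = x i
      tail≠0 : ∀ {α : Vector Carrier (suc n)} → α zero ≈ 0# →
               NonZeroVector α → NonZeroVector (α ∘ suc)
      tail≠0 α₀≈0 (zero  , α₀#0) = contradiction α₀#0 (≈0⇒¬#0 α₀≈0)
      tail≠0 α₀≈0 (suc i , αᵢ#0) = i , αᵢ#0

  -- A geometric sum, with `1 +` on the left in place of a truncated subtraction from `q^n`. The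
  -- induction step uses `1 + (q ∸ 1) ≡ q`, valid as `q` is positive.
  pointCount-geometric : ∀ n → 1 ℕ.+ pointCount n ℕ.* (q ℕ.∸ 1) ≡ q ℕ.^ n
  pointCount-geometric zero    = ≡.refl
  pointCount-geometric (suc n) = ≡.trans
    (+-*-Solver.solve 3 (λ Q P r → con 1 :+ℕ (Q :+ℕ P) :*ℕ r :=ℕ con 1 :+ℕ P :*ℕ r :+ℕ r :*ℕ Q)
       ≡.refl (q ℕ.^ n) (pointCount n) (q ℕ.∸ 1))
    (≡.trans (≡.cong (ℕ._+ (q ℕ.∸ 1) ℕ.* q ℕ.^ n) (pointCount-geometric n))
             (≡.cong (ℕ._* q ℕ.^ n) (ℕ.m+[n∸m]≡n 0<q)))
    where open +-*-Solver using (con) renaming (_:+_ to _:+ℕ_; _:*_ to _:*ℕ_; _:=_ to _:=ℕ_)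

  -- Nondegeneracy of the symplectic form

  J-opposite : ∀ {i j} → i ≢ j → J i (opposite j) ≈ 0#
  J-opposite {zero}     {zero}     i≢j = contradiction ≡.refl i≢j
  J-opposite {zero}     {suc zero} i≢j = refl
  J-opposite {suc zero} {zero}     i≢j = refl
  J-opposite {suc zero} {suc zero} i≢j = contradiction ≡.refl i≢j

  -- The off-diagonal entries of `J` are 1 and -1, so each is its own inverse in every
  -- characteristic. Here `opposite` exchanges the two indices of a block.
  J-opposite² : ∀ i → J i (opposite i) * J i (opposite i) ≈ 1#
  J-opposite² zero       = *-identityˡ 1#
  J-opposite² (suc zero) = trans (-1*x≈-x (- 1#)) (-‿involutive 1#)

  module _ (ν : ℕ) where

    K-combine : ∀ h i c → K ν h (combine i c) ≡
                (if does (quotient {ν} 2 h Fin.≟ i) then J (remainder {ν} 2 h) c else 0#)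
    K-combine h i c = ≡.cong
      (λ (i , c) → if does (quotient {ν} 2 h Fin.≟ i) then J (remainder {ν} 2 h) c else 0#)
      (Fin.remQuot-combine i c)

    -- Every row of K has a single nonzero entry, ±1.
    K-regular : ∀ i → ∃₂ λ j s → ∀ α → α i ≈ s * (α ʳ* K ν) j
    K-regular i = j , s , λ α → begin
      α i                  ≈⟨ *-identityˡ _ ⟨
      1# * α i             ≈⟨ *-congʳ (J-opposite² x) ⟨
      s * s * α i          ≈⟨ solve 2 (λ s a → s :* s :* a := s :* (a :* s)) refl s (α i) ⟩
      s * (α i * s)        ≈⟨ *-congˡ (*-congˡ Kij≈s) ⟨
      s * (α i * K ν i j)  ≈⟨ *-congˡ (sum-single (λ h → α h * K ν h j) i λ h h≢i →
                                trans (*-congˡ (Khj≈0 h h≢i)) (zeroʳ _)) ⟨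
      s * (α ʳ* K ν) j     ∎
      where
      k = quotient {ν} 2 i
      x = remainder {ν} 2 i
      j = combine k (opposite x)
      s = J x (opposite x)
      Kij≈s : K ν i j ≈ s
      Kij≈s rewrite K-combine i k (opposite x) with k Fin.≟ k
      ... | yes _  = refl
      ... | no k≢k = contradiction ≡.refl k≢k
      Khj≈0 : ∀ h → h ≢ i → K ν h j ≈ 0#
      Khj≈0 h h≢i rewrite K-combine h k (opposite x) with quotient {ν} 2 h Fin.≟ k
      ... | no _   = refl
      ... | yes k′ = J-opposite λ x′ → h≢i (≡.trans (≡.sym (Fin.combine-remQuot {ν} 2 h))
        (≡.trans (≡.cong₂ combine k′ x′) (Fin.combine-remQuot {ν} 2 i)))

    row : Vector Carrier (ν ℕ.* 2) → Vector Carrier (ν ℕ.* 2)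
    row α = α ʳ* K ν

    row-nonZero : ∀ {α} → NonZeroVector α → NonZeroVector (row α)
    row-nonZero {α} (i , αᵢ#0) with K-regular i
    ... | j , s , e = j , *-#0ʳ (#-congʳ (e α) αᵢ#0)

    row-proportional : ∀ {α β} a → row α ≋ a · row β → α ≋ a · β
    row-proportional {α} {β} a e i with K-regular i
    ... | j , s , inv = begin
      α i                ≈⟨ inv α ⟩
      s * row α j        ≈⟨ *-congˡ (e j) ⟩
      s * (a * row β j)  ≈⟨ solve 3 (λ s a x → s :* (a :* x) := a :* (s :* x)) refl s a (row β j) ⟩
      a * (s * row β j)  ≈⟨ *-congˡ (inv β) ⟨
      a * β i            ∎

  dual : ∀ {n} (γ : Vector Carrier n) → NonZeroVector γ → ∃[ e ] γ ∙ e ≈ 1#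
  dual γ (i , γᵢ#0) with #-inverse γᵢ#0
  ... | u , uγᵢ≈1 = u · δ i , (begin
    γ ∙ (u · δ i)  ≈⟨ ∙-scaleʳ γ u (δ i) ⟩
    u * (γ ∙ δ i)  ≈⟨ *-congˡ (∙-δ γ i) ⟩
    u * γ i        ≈⟨ uγᵢ≈1 ⟩
    1#             ∎)

  -- The vector v vanishes precisely when γ′ is a multiple of γ; an entry
  -- v j # 0# turns δ j, projected along e to the kernel of γ, into f.
  dualPair : ∀ {n} (γ γ′ : Vector Carrier n) → NonZeroVector γ →
             (∀ a → ¬ γ′ ≋ a · γ) →
             ∃₂ λ e f → (γ ∙ e ≈ 1# × γ ∙ f ≈ 0#) × (γ′ ∙ e ≈ 0# × γ′ ∙ f ≈ 1#)
  dualPair {n} γ γ′ γ≠0 independent with dual γ γ≠0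
  ... | e , γe≈1 with nonZero? v
    where
    v : Vector Carrier n
    v = γ′ +ᵛ (- (γ′ ∙ e)) · γ
  ... | inj₁ v≈0 = contradiction
    (λ j → x-y≈0⇒x≈y _ _ (trans (+-congˡ (-‿distribˡ-* _ _)) (v≈0 j)))
    (independent (γ′ ∙ e))
  -- Subtracting `(γ′ ∙ e) · f` makes `γ′` vanish on the first vector. The value under `γ` stays 1
  -- because `γ` vanishes on `f`.
  ... | inj₂ (j , vⱼ#0) = e +ᵛ (- (γ′ ∙ e)) · f , f ,
    ((begin
       γ ∙ (e +ᵛ (- (γ′ ∙ e)) · f)       ≈⟨ ∙-axpy γ e f _ ⟩
       γ ∙ e + - (γ′ ∙ e) * (γ ∙ f)      ≈⟨ +-cong γe≈1 (trans (*-congˡ γf≈0) (zeroʳ _)) ⟩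
       1# + 0#                           ≈⟨ +-identityʳ 1# ⟩
       1#                                ∎) , γf≈0) ,
    ((begin
       γ′ ∙ (e +ᵛ (- (γ′ ∙ e)) · f)      ≈⟨ ∙-axpy γ′ e f _ ⟩
       γ′ ∙ e + - (γ′ ∙ e) * (γ′ ∙ f)    ≈⟨ +-congˡ (trans (*-congˡ γ′f≈1) (*-identityʳ _)) ⟩
       γ′ ∙ e - γ′ ∙ e                   ≈⟨ -‿inverseʳ _ ⟩
       0#                                ∎) , γ′f≈1)
    where
    u = proj₁ (#-inverse vⱼ#0)
    f₀ = δ j +ᵛ (- γ j) · e
    f = u · f₀
    γf≈0 : γ ∙ f ≈ 0#
    γf≈0 = begin
      γ ∙ f                            ≈⟨ ∙-scaleʳ γ u f₀ ⟩
      u * (γ ∙ f₀)                     ≈⟨ *-congˡ (∙-axpy γ (δ j) e _) ⟩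
      u * (γ ∙ δ j + - γ j * (γ ∙ e))  ≈⟨ *-congˡ (+-cong (∙-δ γ j) (trans (*-congˡ γe≈1) (*-identityʳ _))) ⟩
      u * (γ j - γ j)                  ≈⟨ *-congˡ (-‿inverseʳ _) ⟩
      u * 0#                           ≈⟨ zeroʳ u ⟩
      0#                               ∎
    γ′f≈1 : γ′ ∙ f ≈ 1#
    γ′f≈1 = begin
      γ′ ∙ f                              ≈⟨ ∙-scaleʳ γ′ u f₀ ⟩
      u * (γ′ ∙ f₀)                       ≈⟨ *-congˡ (∙-axpy γ′ (δ j) e _) ⟩
      u * (γ′ ∙ δ j + - γ j * (γ′ ∙ e))   ≈⟨ *-congˡ (+-cong (∙-δ γ′ j) (begin
        - γ j * (γ′ ∙ e)    ≈⟨ -‿distribˡ-* _ _ ⟨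
        - (γ j * (γ′ ∙ e))  ≈⟨ -‿cong (*-comm _ _) ⟩
        - ((γ′ ∙ e) * γ j)  ≈⟨ -‿distribˡ-* _ _ ⟩
        - (γ′ ∙ e) * γ j    ∎)) ⟩
      u * (γ′ j + - (γ′ ∙ e) * γ j)       ≈⟨ proj₂ (#-inverse vⱼ#0) ⟩
      1#                                  ∎

  -- Degrees and numbers of common neighbours

  module _ (ν : ℕ) (1≤ν : 1 ℕ.≤ ν) where

    private
      dim = ν ℕ.* 2

      2≤dim : 2 ℕ.≤ dim
      2≤dim = ℕ.*-monoˡ-≤ 2 1≤ν

      module _ (γ : Vector Carrier dim) where
        ∙-homo : ∀ {x y} a → x ≋ a · y → γ ∙ x ≈ a * (γ ∙ y)
        ∙-homo {y = y} a x≋ay = trans (∙-cong γ x≋ay) (∙-scaleʳ γ a y)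
        open Normalise {dim} {γ ∙_} ∙-homo public

      ∙-#0-scale : ∀ γ {x y : Vector Carrier dim} a → a # 0# → x ≋ a · y →
                   γ ∙ y # 0# → γ ∙ x # 0#
      ∙-#0-scale γ a a#0 x≋ay γy#0 =
        #-congʳ (sym (∙-homo γ a x≋ay)) (x#0y#0→xy#0 a#0 γy#0)

    size-neighbours : ∀ u → HasSize (SimpleGraph.neighbours (Sp F ν) u)
                                    (q ℕ.^ (dim ℕ.∸ 1) ℕ.* 1)
    size-neighbours (α , α≠0) = size-via
      (normalise γ (∙-#0-scale γ) id)
      (Fibres.size-fibres {k = 1} (λ _ → γ) (λ a → a zero · e) (λ a≋b i → *-congʳ (a≋b zero))
        (λ { a zero → trans (∙-scaleʳ γ (a zero) e)
                            (trans (*-congˡ (proj₂ (dual γ (row-nonZero ν α≠0)))) (*-identityʳ _)) })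
        (ℕ.≤-trans (ℕ.s≤s ℕ.z≤n) 2≤dim)
        -- After normalisation 1 is the only admissible value of `γ`; this is the factor 1 in the
        -- size.
        {Q = λ a → a zero ≈ 1# × a zero # 0#}
        (λ a≋b (e , p) → trans (sym (a≋b zero)) e , #-congʳ (a≋b zero) p)
        (size-singleton ((λ _ → 1#) , refl , 1#0) λ { (_ , e , _) zero → sym e }))
      where
      γ = row ν α
      e = proj₁ (dual γ (row-nonZero ν α≠0))

    -- Only the linear independence of the rows `γ` and `γ′` enters, so one count serves adjacent
    -- and non-adjacent pairs, giving equal λ and μ. The value under `γ` is normalised to 1, and
    -- that under `γ′` ranges over the `q ∸ 1` units.
    size-commonNeighbours :
      ∀ u w → SimpleGraph._≉_ (Sp F ν) u w →
      HasSize (SimpleGraph.commonNeighbours (Sp F ν) u w)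
              (q ℕ.^ (dim ℕ.∸ 2) ℕ.* (q ℕ.∸ 1))
    size-commonNeighbours (α , α≠0) (β , β≠0) α≉β = size-via
      (normalise γ {P = λ x → γ ∙ x # 0# × γ′ ∙ x # 0#}
        (λ a a#0 e (p , p′) → ∙-#0-scale γ a a#0 e p , ∙-#0-scale γ′ a a#0 e p′) proj₁)
      (Fibres.size-fibres Γ section
        (λ a≋b i → +-cong (*-congʳ (a≋b zero)) (*-congʳ (a≋b (suc zero))))
        Φ∘section 2≤dim {Q = Q}
        (λ a≋b (e , p , p′) → trans (sym (a≋b zero)) e ,
          #-congʳ (a≋b zero) p , #-congʳ (a≋b (suc zero)) p′)
        (size-via Q≅units size-units))
      where
      γ = row ν α
      γ′ = row ν β
      -- By nondegeneracy a dependence between the rows is one between `α` and `β`, which would make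
      -- the two points equal.
      pair = dualPair γ γ′ (row-nonZero ν α≠0) λ a γ′≋aγ → α≉β
        (Setoid.sym (points dim) {β , β≠0} {α , α≠0}
          (proportional⇒≐ β α a β≠0 (row-proportional ν a γ′≋aγ)))
      e = proj₁ pair
      f = proj₁ (proj₂ pair)
      Γ : Fin 2 → Vector Carrier dim
      Γ zero       = γ
      Γ (suc zero) = γ′
      section : Vector Carrier 2 → Vector Carrier dim
      section a = a zero · e +ᵛ a (suc zero) · f
      Φ∘section : ∀ a i → Γ i ∙ section a ≈ a i
      Φ∘section a i = trans (∙-axpy (Γ i) (a zero · e) f _)
        (trans (+-congʳ (∙-scaleʳ (Γ i) _ e)) (coordinate i))
        where
        coordinate : ∀ i → a zero * (Γ i ∙ e) + a (suc zero) * (Γ i ∙ f) ≈ a i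
        coordinate zero = let γe≈1 , γf≈0 = proj₁ (proj₂ (proj₂ pair)) in
          trans (+-cong (trans (*-congˡ γe≈1) (*-identityʳ _)) (trans (*-congˡ γf≈0) (zeroʳ _)))
                (+-identityʳ _)
        coordinate (suc zero) = let γ′e≈0 , γ′f≈1 = proj₂ (proj₂ (proj₂ pair)) in
          trans (+-cong (trans (*-congˡ γ′e≈0) (zeroʳ _)) (trans (*-congˡ γ′f≈1) (*-identityʳ _)))
                (+-identityˡ _)
      Q : Pred (Vector Carrier 2) _
      Q a = a zero ≈ 1# × a zero # 0# × a (suc zero) # 0#
      Q≅units : Inverse (Restrict (≋-setoid 2) Q) (Restrict setoid (_# 0#))
      Q≅units = mk-inverse
        (λ (a , _ , _ , p) → a (suc zero) , p)
        (λ (x , x#0) → (λ { zero → 1# ; (suc zero) → x }) , refl , 1#0 , x#0)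
        (λ a≋b → a≋b (suc zero))
        (λ { x≈y zero → refl ; x≈y (suc zero) → x≈y })
        (λ _ → refl)
        (λ { (_ , e , _) zero → sym e ; _ (suc zero) → refl })

  -- Explicit adjacent and non-adjacent points, and the case of the projective line

  module _ (ν : ℕ) where
    open Symplectic heytingField using (form)

    form-δ : ∀ i j → form ν (δ i) (δ j) ≈ K ν i j
    form-δ i j = begin
      row ν (δ i) ∙ δ j               ≈⟨ ∙-δ (row ν (δ i)) j ⟩
      sum (λ h → δ i h * K ν h j)     ≈⟨ sum-cong-≋ (λ h → *-comm (δ i h) (K ν h j)) ⟩
      (λ h → K ν h j) ∙ δ i           ≈⟨ ∙-δ (λ h → K ν h j) i ⟩
      K ν i j                         ∎

    unitPoint : Fin (ν ℕ.* 2) → SimpleGraph.Vertex (Sp F ν)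
    unitPoint i = δ i , i , ≈1⇒#0 (δ-refl i)

    unitPoint-injective : ∀ {i j} → i ≢ j → SimpleGraph._≉_ (Sp F ν) (unitPoint i) (unitPoint j)
    unitPoint-injective {i} {j} i≢j eᵢ≈eⱼ with ≐⇒proportional (δ i) (δ j) eᵢ≈eⱼ
    ... | a , δᵢ≋aδⱼ = ≈0⇒¬#0
      (trans (δᵢ≋aδⱼ i) (trans (*-congˡ (δ-≢ (i≢j ∘ ≡.sym))) (zeroʳ a)))
      (≈1⇒#0 (δ-refl i))

  -- Indices 0 and 1 lie in the first block of `K`, where the entry is 1.
  unitPoints-adjacent : ∀ ν → SimpleGraph.Adj (Sp F (suc ν)) (unitPoint (suc ν) zero)
                                                           (unitPoint (suc ν) (suc zero))
  unitPoints-adjacent ν = ≈1⇒#0 (form-δ (suc ν) zero (suc zero))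

  -- Index 2 opens the second block, so the entry of `K` at 0 and 2 is 0. The parameter `2 + ν`
  -- guarantees a second block.
  unitPoints-nonAdjacent : ∀ ν → ¬ SimpleGraph.Adj (Sp F (2 ℕ.+ ν))
                                   (unitPoint (2 ℕ.+ ν) zero)
                                   (unitPoint (2 ℕ.+ ν) (suc (suc zero)))
  unitPoints-nonAdjacent ν = ≈0⇒¬#0 (form-δ (2 ℕ.+ ν) zero (suc (suc zero)))

  -- In dimension two the form is the determinant of the two vectors. If it vanishes they are
  -- proportional, with scalar `u * β i` for `u` inverse to a nonzero entry `α i`.
  Sp₁-complete : ∀ u w → SimpleGraph._≉_ (Sp F 1) u w → SimpleGraph.Adj (Sp F 1) u w
  Sp₁-complete (α , i , αᵢ#0) (β , β≠0) α≉β with zero? (Symplectic.form heytingField 1 α β)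
  ... | inj₂ αβ#0 = αβ#0
  ... | inj₁ αβ≈0 = contradiction
    (Setoid.sym (points 2) {β , β≠0} {α , i , αᵢ#0}
      (proportional⇒≐ β α (u * β i) β≠0 λ j → begin
        β j               ≈⟨ *-identityˡ _ ⟨
        1# * β j          ≈⟨ *-congʳ uαᵢ≈1 ⟨
        u * α i * β j     ≈⟨ *-assoc _ _ _ ⟩
        u * (α i * β j)   ≈⟨ *-congˡ (cross i j) ⟩
        u * (α j * β i)   ≈⟨ solve 3 (λ u a b → u :* (a :* b) := u :* b :* a) refl u (α j) (β i) ⟩
        u * β i * α j     ∎))
    α≉β
    where
    u = proj₁ (#-inverse αᵢ#0)
    uαᵢ≈1 = proj₂ (#-inverse αᵢ#0)
    row₀ : row 1 α zero ≈ - α (suc zero)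
    row₀ = trans (+-cong (zeroʳ _) (trans (+-identityʳ _) (trans (*-comm _ _) (-1*x≈-x _))))
                 (+-identityˡ _)
    row₁ : row 1 α (suc zero) ≈ α zero
    row₁ = trans (+-cong (*-identityʳ _) (trans (+-identityʳ _) (zeroʳ _))) (+-identityʳ _)
    determinant : α zero * β (suc zero) ≈ α (suc zero) * β zero
    determinant = x-y≈0⇒x≈y _ _ (begin
      α zero * β (suc zero) - α (suc zero) * β zero
        ≈⟨ +-comm _ _ ⟩
      - (α (suc zero) * β zero) + α zero * β (suc zero)
        ≈⟨ +-cong (trans (-‿distribˡ-* _ _) (*-congʳ (sym row₀)))
                  (trans (*-congʳ (sym row₁)) (sym (+-identityʳ _))) ⟩
      Symplectic.form heytingField 1 α β
        ≈⟨ αβ≈0 ⟩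
      0# ∎)
    cross : ∀ i j → α i * β j ≈ α j * β i
    cross zero       zero       = refl
    cross zero       (suc zero) = determinant
    cross (suc zero) zero       = sym determinant
    cross (suc zero) (suc zero) = refl

  Sp-stronglyRegular : ∀ ν → 1 ℕ.≤ ν →
    IsStronglyRegular (Sp F ν) (pointCount (2 ℕ.* ν)) (q ℕ.^ (2 ℕ.* ν ℕ.∸ 1))
      (q ℕ.^ (2 ℕ.* ν ℕ.∸ 2) ℕ.* (q ℕ.∸ 1)) (q ℕ.^ (2 ℕ.* ν ℕ.∸ 2) ℕ.* (q ℕ.∸ 1))
  -- Vectors have `ν * 2` coordinates, while the parameters are stated with `2 * ν`.
  Sp-stronglyRegular ν 1≤ν rewrite ℕ.*-comm 2 ν = record
    { order       = size-points (ν ℕ.* 2)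
    ; degree      = λ u → ≡.subst (HasSize _) (ℕ.*-identityʳ _) (size-neighbours ν 1≤ν u)
    ; adjacent    = λ u w u≉w _ → size-commonNeighbours ν 1≤ν u w u≉w
    ; nonAdjacent = λ u w u≉w _ → size-commonNeighbours ν 1≤ν u w u≉w
    }

-- Eigenvalues of strongly regular graphs with λ = μ

-- Writing the degree as `r * r + m` builds into the parameters that the diagonal and off-diagonal
-- entries of the squared adjacency matrix differ by the square of `r`.
module Spectrum (G : SimpleGraph a b c) {v r m : ℕ}
                (G-srg : IsStronglyRegular G v (r ℕ.* r ℕ.+ m) m m)
                (0<r : 0 ℕ.< r) (0<m : 0 ℕ.< m)
                (L : HeytingField d ℓ p) (char0 : LinearAlgebra.CharacteristicZero L)
                {n} (enum : HasSize (SimpleGraph.vertices G) n) where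

  open HeytingLinear L
  open SemiringMult semiring using (×-homo-+; ×1-homo-*)

  private
    module G = SimpleGraph G
    module enum = Inverse enum
    module V = Setoid G.vertices
    open IsStronglyRegular G-srg

  A : Matrix n
  A = adjacencyMatrix G enum L

  k : ℕ
  k = r ℕ.* r ℕ.+ m

  ρ κ μ : Carrier
  ρ = fromℕ r
  κ = fromℕ k
  μ = fromℕ m

  0<k : 0 ℕ.< k
  0<k = ℕ.≤-trans 0<m (ℕ.m≤n+m m (r ℕ.* r))

  fromℕ-#0 : ∀ {x} → 0 ℕ.< x → fromℕ x # 0#
  fromℕ-#0 {suc x} _ = char0 x

  κ≈ρ²+μ : κ ≈ ρ * ρ + μ
  κ≈ρ²+μ = trans (×-homo-+ 1# (r ℕ.* r) m) (+-congʳ (×1-homo-* r r))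

  -- The difference is the image of `x + y`, a positive integer, which is apart from 0 in
  -- characteristic zero.
  fromℕ#-fromℕ : ∀ x y → 0 ℕ.< x → fromℕ x # - fromℕ y
  fromℕ#-fromℕ x y 0<x = -#0⇒# (#-congʳ
    (trans (×-homo-+ 1# x y) (+-congˡ (sym (-‿involutive _))))
    (fromℕ-#0 (ℕ.≤-trans 0<x (ℕ.m≤m+n x y))))

  -- As `r` is at most its square and `m` is positive, `k ∸ r` is a positive integer.
  κ#ρ : κ # ρ
  κ#ρ = -#0⇒# (#-congʳ κ-ρ≈ (fromℕ-#0 (ℕ.m<n⇒0<n∸m r<k)))
    where
    instance
      _ = ℕ.>-nonZero 0<r
    r<k : r ℕ.< k
    r<k = ℕ.≤-<-trans (ℕ.m≤m*n r r) (ℕ.m<m+n (r ℕ.* r) 0<m)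
    κ-ρ≈ : fromℕ (k ℕ.∸ r) ≈ κ - ρ
    κ-ρ≈ = begin
      fromℕ (k ℕ.∸ r)              ≈⟨ +-identityʳ _ ⟨
      fromℕ (k ℕ.∸ r) + 0#         ≈⟨ +-congˡ (-‿inverseʳ ρ) ⟨
      fromℕ (k ℕ.∸ r) + (ρ - ρ)    ≈⟨ +-assoc _ _ _ ⟨
      fromℕ (k ℕ.∸ r) + ρ - ρ      ≈⟨ +-congʳ (×-homo-+ 1# (k ℕ.∸ r) r) ⟨
      fromℕ (k ℕ.∸ r ℕ.+ r) - ρ    ≡⟨ ≡.cong (λ x → fromℕ x - ρ) (ℕ.m∸n+n≡m (ℕ.<⇒≤ r<k)) ⟩
      κ - ρ                        ∎

  -- The square of the adjacency matrix

  sum-indicator : ∀ {n} {P : Pred (Fin n) q} (P? : Decidable P) →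
                  sum (λ i → if does (P? i) then 1# else 0#) ≈ fromℕ (count P?)
  sum-indicator {n = zero}  P? = refl
  sum-indicator {n = suc n} P? with P? zero
  ... | yes _ = +-congˡ (sum-indicator (P? ∘ suc))
  ... | no  _ = trans (+-identityˡ _) (sum-indicator (P? ∘ suc))

  from-injective : ∀ {i j} → enum.from i G.≈ enum.from j → i ≡ j
  from-injective e =
    ≡.trans (≡.sym (enum.inverseˡ V.refl)) (≡.trans (enum.to-cong e) (enum.inverseˡ V.refl))

  A-adjacent : ∀ {i j} → G.Adj (enum.from i) (enum.from j) → A i j ≈ 1#
  A-adjacent {i} {j} adj with G.adj? (enum.from i) (enum.from j)
  ... | yes _   = refl
  ... | no ¬adj = contradiction adj ¬adj

  A-nonAdjacent : ∀ {i j} → ¬ G.Adj (enum.from i) (enum.from j) → A i j ≈ 0#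
  A-nonAdjacent {i} {j} ¬adj with G.adj? (enum.from i) (enum.from j)
  ... | yes adj = contradiction adj ¬adj
  ... | no _    = refl

  A-sym : ∀ i j → A i j ≈ A j i
  A-sym i j with G.adj? (enum.from i) (enum.from j)
  ... | yes adj = sym (A-adjacent (G.adj-sym adj))
  ... | no ¬adj = sym (A-nonAdjacent (¬adj ∘ G.adj-sym))

  private
    Adj-respʳ : ∀ {u x y} → x G.≈ y → G.Adj u x → G.Adj u y
    Adj-respʳ = proj₁ G.adj-resp-≈

  A-degree : ∀ i → sum (A i) ≈ κ
  A-degree i = trans (sum-indicator (adj?ᵢ ∘ enum.from)) (reflexive (≡.cong fromℕ
    (size-unique (size-restrict enum Adj-respʳ adj?ᵢ) (degree (enum.from i)))))
    where
    adj?ᵢ = G.adj? (enum.from i)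

  -- By symmetry of `A` the entry counts common neighbours of vertices `i` and `l`: this is the
  -- degree on the diagonal and `m` off it, whether or not the vertices are adjacent.
  A² : ∀ i l → sum (λ j → A i j * A j l) ≈ μ + ρ * ρ * δ i l
  A² i l = begin
    sum (λ j → A i j * A j l)                  ≈⟨ sum-cong-≋ product ⟩
    sum (λ j → if does (common? (enum.from j)) then 1# else 0#)
      ≈⟨ sum-indicator (common? ∘ enum.from) ⟩
    fromℕ (count (common? ∘ enum.from))        ≈⟨ size (i Fin.≟ l) ⟩
    μ + ρ * ρ * δ i l                          ∎
    where
    u = enum.from i
    w = enum.from l
    common? : Decidable λ x → G.Adj u x × G.Adj w x
    common? x = G.adj? u x ×-dec G.adj? w x
    product : ∀ j → A i j * A j l ≈ (if does (common? (enum.from j)) then 1# else 0#)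
    product j = trans (*-congˡ (A-sym j l)) helper
      where
      helper : A i j * A l j ≈ (if does (common? (enum.from j)) then 1# else 0#)
      helper with G.adj? u (enum.from j)
      ... | yes _ = *-identityˡ _
      ... | no  _ = zeroˡ _
    size-common = size-restrict enum {P = λ x → G.Adj u x × G.Adj w x}
      (λ x≈y (p , p′) → Adj-respʳ x≈y p , Adj-respʳ x≈y p′) common?
    size : Dec (i ≡ l) → fromℕ (count (common? ∘ enum.from)) ≈ μ + ρ * ρ * δ i l
    size (yes ≡.refl) = begin
      fromℕ (count (common? ∘ enum.from))
        ≡⟨ ≡.cong fromℕ (size-unique size-common
             (size-via (Restrict-cong G.vertices proj₁ (λ p → p , p)) (degree u))) ⟩
      κ                    ≈⟨ κ≈ρ²+μ ⟩
      ρ * ρ + μ            ≈⟨ +-comm _ _ ⟩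
      μ + ρ * ρ            ≈⟨ +-congˡ (*-identityʳ _) ⟨
      μ + ρ * ρ * 1#       ≈⟨ +-congˡ (*-congˡ (δ-refl i)) ⟨
      μ + ρ * ρ * δ i i    ∎
    size (no i≢l) = begin
      fromℕ (count (common? ∘ enum.from))  ≡⟨ ≡.cong fromℕ (size-unique size-common size-m) ⟩
      μ                    ≈⟨ +-identityʳ _ ⟨
      μ + 0#               ≈⟨ +-congˡ (zeroʳ _) ⟨
      μ + ρ * ρ * 0#       ≈⟨ +-congˡ (*-congˡ (δ-≢ i≢l)) ⟨
      μ + ρ * ρ * δ i l    ∎
      where
      size-m : HasSize (G.commonNeighbours u w) m
      size-m with G.adj? u w
      ... | yes adj = adjacent u w (i≢l ∘ from-injective) adj
      ... | no ¬adj = nonAdjacent u w (i≢l ∘ from-injective) ¬adj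

  A²*x : ∀ x i → (A *ᶜ (A *ᶜ x)) i ≈ μ * sum x + ρ * ρ * x i
  A²*x x i = begin
    sum (λ j → A i j * sum (λ l → A j l * x l))
      ≈⟨ sum-cong-≋ (λ j → trans (*-distribˡ-sum (A i j) (λ l → A j l * x l))
           (sum-cong-≋ λ l → sym (*-assoc (A i j) (A j l) (x l)))) ⟩
    sum (λ j → sum λ l → A i j * A j l * x l)
      ≈⟨ ∑-comm (λ j l → A i j * A j l * x l) ⟩
    sum (λ l → sum λ j → A i j * A j l * x l)
      ≈⟨ sum-cong-≋ (λ l → trans (sym (*-distribʳ-sum (x l) (λ j → A i j * A j l)))
           (trans (*-congʳ (A² i l))
             (solve 4 (λ μ r d x → (μ :+ r :* d) :* x := μ :* x :+ r :* (x :* d))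
                refl μ (ρ * ρ) (δ i l) (x l)))) ⟩
    sum (λ l → μ * x l + ρ * ρ * (x l * δ i l))
      ≈⟨ ∑-distrib-+ (λ l → μ * x l) (λ l → ρ * ρ * (x l * δ i l)) ⟩
    sum (λ l → μ * x l) + sum (λ l → ρ * ρ * (x l * δ i l))
      ≈⟨ +-cong (*-distribˡ-sum μ x) (*-distribˡ-sum (ρ * ρ) (λ l → x l * δ i l)) ⟨
    μ * sum x + ρ * ρ * (x ∙ δ i)
      ≈⟨ +-congˡ (*-congˡ (∙-δ x i)) ⟩
    μ * sum x + ρ * ρ * x i ∎

  -- Constraints on an eigenvalue

  module Eigenvector {t x} (Ax≋tx : (A *ᶜ x) ≋ t · x) where

    -- Summing the entries of `A x = t x` brings in the column sums of `A`, which by symmetry are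
    -- all `κ`.
    t*sum≈κ*sum : t * sum x ≈ κ * sum x
    t*sum≈κ*sum = begin
      t * sum x                                ≈⟨ *-distribˡ-sum t x ⟩
      sum (t · x)                              ≈⟨ sum-cong-≋ Ax≋tx ⟨
      sum (λ i → sum λ j → A i j * x j)        ≈⟨ ∑-comm (λ i j → A i j * x j) ⟩
      sum (λ j → sum λ i → A i j * x j)
        ≈⟨ sum-cong-≋ (λ j → trans (sym (*-distribʳ-sum (x j) (λ i → A i j)))
             (*-congʳ (trans (sum-cong-≋ λ i → A-sym i j) (A-degree j)))) ⟩
      sum (κ · x)                              ≈⟨ *-distribˡ-sum κ x ⟨
      κ * sum x                                ∎

    t²x : ∀ i → t * (t * x i) ≈ μ * sum x + ρ * ρ * x i
    t²x i = begin
      t * (t * x i)                  ≈⟨ *-congˡ (Ax≋tx i) ⟨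
      t * (A i ∙ x)                  ≈⟨ ∙-scaleʳ (A i) t x ⟨
      A i ∙ (t · x)                  ≈⟨ ∙-cong (A i) Ax≋tx ⟨
      (A *ᶜ (A *ᶜ x)) i              ≈⟨ A²*x x i ⟩
      μ * sum x + ρ * ρ * x i        ∎

    t#κ⇒sum≈0 : t # κ → sum x ≈ 0#
    t#κ⇒sum≈0 t#κ = #∧*≈⇒≈0 t#κ t*sum≈κ*sum

    -- When the entries of `x` sum to 0, `(t - c) * (t + c) * x i` vanishes. The first factor
    -- cancels by `t # c`, the last by `x i # 0`. It is applied with `c` equal to `ρ` and to `- ρ`.
    ±-root : ∀ i → x i # 0# → sum x ≈ 0# → ∀ c → c * c ≈ ρ * ρ → t # c → t ≈ - c
    ±-root i xᵢ#0 s≈0 c c²≈ρ² t#c = x-y≈0⇒x≈y _ _ (begin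
      t - - c  ≈⟨ +-congˡ (-‿involutive c) ⟩
      t + c    ≈⟨ *-cancelˡ-0 xᵢ#0 (trans (*-comm _ _) (#∧*≈⇒≈0 t#c t*y≈c*y)) ⟩
      0#       ∎)
      where
      t*y≈c*y : t * ((t + c) * x i) ≈ c * ((t + c) * x i)
      t*y≈c*y = begin
        t * ((t + c) * x i)
          ≈⟨ solve 3 (λ t c x → t :* ((t :+ c) :* x) := t :* (t :* x) :+ c :* t :* x)
               refl t c (x i) ⟩
        t * (t * x i) + c * t * x i
          ≈⟨ +-congʳ (trans (t²x i) (trans (+-congʳ (trans (*-congˡ s≈0) (zeroʳ _))) (+-identityˡ _))) ⟩
        ρ * ρ * x i + c * t * x i
          ≈⟨ +-congʳ (*-congʳ c²≈ρ²) ⟨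
        c * c * x i + c * t * x i
          ≈⟨ solve 3 (λ t c x → c :* c :* x :+ c :* t :* x := c :* ((t :+ c) :* x))
               refl t c (x i) ⟩
        c * ((t + c) * x i) ∎

  -ρ² : - ρ * - ρ ≈ ρ * ρ
  -ρ² = trans (sym (-‿distribˡ-* ρ (- ρ))) (trans (-‿cong (sym (-‿distribʳ-* ρ ρ))) (-‿involutive _))

  eigenvalue-cases : ∀ t → IsEigenvalue A t → t ≈ κ ⊎ t ≈ ρ ⊎ t ≈ - ρ
  eigenvalue-cases t (x , (i , xᵢ#0) , Ax≋tx) = cases (#-cotrans κ#ρ t)
    where
    open Eigenvector {t} {x} Ax≋tx
    ρ#t⇒ : κ # t → ρ # t → t ≈ - ρ
    ρ#t⇒ κ#t ρ#t = ±-root i xᵢ#0 (t#κ⇒sum≈0 (#-sym κ#t)) ρ refl (#-sym ρ#t)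
    t#-ρ⇒ : κ # t → t # - ρ → t ≈ ρ
    t#-ρ⇒ κ#t t#-ρ = trans
      (±-root i xᵢ#0 (t#κ⇒sum≈0 (#-sym κ#t)) (- ρ) -ρ² t#-ρ) (-‿involutive ρ)
    cases : κ # t ⊎ t # ρ → t ≈ κ ⊎ t ≈ ρ ⊎ t ≈ - ρ
    cases (inj₁ κ#t) with #-cotrans (fromℕ#-fromℕ r r 0<r) t
    ... | inj₁ ρ#t  = inj₂ (inj₂ (ρ#t⇒ κ#t ρ#t))
    ... | inj₂ t#-ρ = inj₂ (inj₁ (t#-ρ⇒ κ#t t#-ρ))
    cases (inj₂ t#ρ) with #-cotrans (fromℕ#-fromℕ k r 0<k) t
    ... | inj₁ κ#t  = inj₂ (inj₂ (ρ#t⇒ κ#t (#-sym t#ρ)))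
    -- Now `t` is apart from both `ρ` and `- ρ`. Were it also apart from `κ`, it would equal `ρ`, so
    -- tightness gives `t ≈ κ`.
    ... | inj₂ t#-ρ = inj₁ (proj₁ (tight t κ) λ t#κ →
      ≈0⇒¬#0 (x≈y⇒x-y≈0 (t#-ρ⇒ (#-sym t#κ) t#-ρ)) (#⇒-#0 t#ρ))

  -- For a complete graph `A` plus the identity is the all-ones matrix, so an eigenvector with
  -- entries summing to 0 satisfies `(t + 1) x = 0`.
  complete-eigenvalue-cases : (∀ u w → u G.≉ w → G.Adj u w) →
                              ∀ t → IsEigenvalue A t → t ≈ κ ⊎ t ≈ - fromℕ 1
  complete-eigenvalue-cases complete t (x , (i , xᵢ#0) , Ax≋tx) =
    Sum.map (λ t#-1 → proj₁ (tight t κ) λ t#κ →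
               ≈0⇒¬#0 (x≈y⇒x-y≈0 (t≈-1 (#-sym t#κ))) (#⇒-#0 t#-1))
            t≈-1 (Sum.swap (#-cotrans (fromℕ#-fromℕ k 1 0<k) t))
    where
    open Eigenvector {t} {x} Ax≋tx
    A+δ≈1 : ∀ j → A i j + δ i j ≈ 1#
    A+δ≈1 j with i Fin.≟ j
    ... | yes ≡.refl = trans (+-congʳ (A-nonAdjacent (G.adj-irrefl V.refl))) (+-identityˡ 1#)
    ... | no i≢j     = trans (+-congʳ (A-adjacent (complete _ _ (i≢j ∘ from-injective))))
                             (+-identityʳ 1#)
    t≈-1 : κ # t → t ≈ - fromℕ 1
    t≈-1 κ#t = x-y≈0⇒x≈y _ _ (begin
      t - - fromℕ 1    ≈⟨ +-congˡ (trans (-‿involutive _) (+-identityʳ 1#)) ⟩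
      t + 1#           ≈⟨ *-cancelˡ-0 xᵢ#0 (begin
        x i * (t + 1#)                   ≈⟨ distribˡ _ _ _ ⟩
        x i * t + x i * 1#               ≈⟨ +-cong (trans (*-comm _ _) (sym (Ax≋tx i))) (*-identityʳ _) ⟩
        A i ∙ x + x i                    ≈⟨ +-congˡ (trans (sum-cong-≋ λ j → *-comm (δ i j) (x j)) (∙-δ x i)) ⟨
        A i ∙ x + δ i ∙ x                ≈⟨ ∑-distrib-+ (λ j → A i j * x j) (λ j → δ i j * x j) ⟨
        sum (λ j → A i j * x j + δ i j * x j)
          ≈⟨ sum-cong-≋ (λ j → trans (sym (distribʳ (x j) (A i j) (δ i j)))
               (trans (*-congʳ (A+δ≈1 j)) (*-identityˡ _))) ⟩
        sum x                            ≈⟨ t#κ⇒sum≈0 (#-sym κ#t) ⟩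
        0#                               ∎) ⟩
      0#               ∎)

  -- Construction of eigenvectors

  κ-eigenvalue : Fin n → IsEigenvalue A κ
  -- The index `i` ensures that the all-ones vector has an entry, hence is nonzero.
  κ-eigenvalue i = (λ _ → 1#) , (i , 1#0) , λ j →
    trans (sum-cong-≋ λ l → *-identityʳ (A j l)) (trans (A-degree j) (sym (*-identityʳ κ)))

  -- (A + c) y is an eigenvector for c when c² = ρ² and y is orthogonal to the
  -- all-ones vector, because then A² y = ρ² y; here y = δ i - δ l.
  ±-eigenvalue : ∀ {i l} → i ≢ l → ∀ c → c * c ≈ ρ * ρ → c - A i l # 0# →
                 IsEigenvalue A c
  ±-eigenvalue {i} {l} i≢l c c²≈ρ² c-A#0 = z , (i , #-congʳ (sym zᵢ≈) c-A#0) , λ j → begin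
    A j ∙ z                                     ≈⟨ ∙-axpy (A j) (A *ᶜ y) y c ⟩
    (A *ᶜ (A *ᶜ y)) j + c * (A *ᶜ y) j          ≈⟨ +-congʳ (A²*x y j) ⟩
    μ * sum y + ρ * ρ * y j + c * (A *ᶜ y) j
      ≈⟨ +-congʳ (trans (+-congʳ (trans (*-congˡ sum-y) (zeroʳ _))) (+-identityˡ _)) ⟩
    ρ * ρ * y j + c * (A *ᶜ y) j                ≈⟨ +-congʳ (*-congʳ c²≈ρ²) ⟨
    c * c * y j + c * (A *ᶜ y) j
      ≈⟨ solve 3 (λ c y w → c :* c :* y :+ c :* w := c :* (w :+ c :* y)) refl c (y j) ((A *ᶜ y) j) ⟩
    c * z j                                     ∎
    where
    y = δ i +ᵛ (- 1#) · δ l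
    z = (A *ᶜ y) +ᵛ c · y
    ∙-y : ∀ x → x ∙ y ≈ x i - x l
    ∙-y x = trans (∙-axpy x (δ i) (δ l) (- 1#))
      (+-cong (∙-δ x i) (trans (-1*x≈-x _) (-‿cong (∙-δ x l))))
    sum-y : sum y ≈ 0#
    sum-y = trans (sum-cong-≋ λ j → sym (*-identityˡ (y j)))
      (trans (∙-y (λ _ → 1#)) (-‿inverseʳ 1#))
    y-i : y i ≈ 1#
    y-i = trans (+-cong (δ-refl i) (trans (*-congˡ (δ-≢ (i≢l ∘ ≡.sym))) (zeroʳ _))) (+-identityʳ 1#)
    -- This entry witnesses that `z` is nonzero; the diagonal entry `A i i` is 0, as a vertex is not
    -- adjacent to itself.
    zᵢ≈ : z i ≈ c - A i l
    zᵢ≈ = begin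
      A i ∙ y + c * y i        ≈⟨ +-cong (∙-y (A i)) (trans (*-congˡ y-i) (*-identityʳ c)) ⟩
      A i i - A i l + c        ≈⟨ +-congʳ (trans (+-congʳ (A-nonAdjacent (G.adj-irrefl V.refl))) (+-identityˡ _)) ⟩
      - A i l + c              ≈⟨ +-comm _ _ ⟩
      c - A i l                ∎

  private
    from∘to : ∀ u → enum.from (enum.to u) G.≈ u
    from∘to u = enum.inverseʳ ≡.refl

    to-injective : ∀ {u w} → u G.≉ w → enum.to u ≢ enum.to w
    to-injective u≉w e = u≉w (V.trans (V.sym (from∘to _)) (enum.inverseʳ e))

    adj-from∘to : ∀ {u w} → G.Adj u w → G.Adj (enum.from (enum.to u)) (enum.from (enum.to w))
    adj-from∘to adj = Adj-respʳ (V.sym (from∘to _))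
      (proj₂ G.adj-resp-≈ (V.sym (from∘to _)) adj)

    adj-from∘to⁻ : ∀ {u w} → G.Adj (enum.from (enum.to u)) (enum.from (enum.to w)) → G.Adj u w
    adj-from∘to⁻ adj = Adj-respʳ (from∘to _) (proj₂ G.adj-resp-≈ (from∘to _) adj)

  ρ-eigenvalue : ∀ {u w} → u G.≉ w → ¬ G.Adj u w → IsEigenvalue A ρ
  ρ-eigenvalue {u} {w} u≉w ¬adj = ±-eigenvalue (to-injective u≉w) ρ refl (#-congʳ
    (sym (trans (+-congˡ (trans (-‿cong (A-nonAdjacent (¬adj ∘ adj-from∘to⁻))) -0#≈0#))
                (+-identityʳ ρ)))
    (fromℕ-#0 0<r))

  -- For an adjacent pair the witnessing entry is `- ρ - 1`, nonzero because 1 is apart from `- ρ`.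
  -ρ-eigenvalue : ∀ {u w} → G.Adj u w → IsEigenvalue A (- ρ)
  -ρ-eigenvalue {u} {w} adj = ±-eigenvalue (to-injective λ u≈w → G.adj-irrefl u≈w adj)
    (- ρ) -ρ² (#-congʳ (+-congˡ (-‿cong (trans (+-identityʳ 1#)
      (sym (A-adjacent (adj-from∘to adj))))))
      (#⇒-#0 (#-sym (fromℕ#-fromℕ 1 r (ℕ.s≤s ℕ.z≤n)))))

  eigenvalue-resp : ∀ {s t} → s ≈ t → IsEigenvalue A s → IsEigenvalue A t
  eigenvalue-resp s≈t (x , x≠0 , e) = x , x≠0 , λ i → trans (e i) (*-congʳ s≈t)

-- The spectrum of the symplectic graph

module _ {q} (F : FiniteField q c ℓ r) where
  open FiniteLinear F using
    ( 0<q; pointCount; unitPoint; unitPoint-injective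
    ; unitPoints-adjacent; unitPoints-nonAdjacent; Sp₁-complete; Sp-stronglyRegular )

  -- The graph parameter is `suc ν`, so `ν ≡ 0` is the projective line. This dichotomy decides
  -- whether `ρ` occurs as an eigenvalue.
  complete-or-nonAdjacent : ∀ ν → let open SimpleGraph (Sp F (suc ν)) in
    (ν ≡ 0 × (∀ u w → u ≉ w → Adj u w)) ⊎
    (2 ℕ.≤ suc ν × ∃₂ λ u w → u ≉ w × ¬ Adj u w)
  complete-or-nonAdjacent zero    = inj₁ (≡.refl , Sp₁-complete)
  complete-or-nonAdjacent (suc ν) = inj₂ (ℕ.s≤s (ℕ.s≤s ℕ.z≤n) ,
    unitPoint (2 ℕ.+ ν) zero , unitPoint (2 ℕ.+ ν) (suc (suc zero)) ,
    unitPoint-injective (2 ℕ.+ ν) {zero} {suc (suc zero)} (λ ()) , unitPoints-nonAdjacent ν)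

  module _ (1<q : 1 ℕ.< q) (ν : ℕ) where
    private
      instance
        _ = ℕ.>-nonZero 0<q
      ρ μ : ℕ
      ρ = q ℕ.^ ν
      μ = q ℕ.^ (2 ℕ.* suc ν ℕ.∸ 2) ℕ.* (q ℕ.∸ 1)

    -- One factor `q` is split as `1 + (q ∸ 1)`; the remaining power `q^(ν + ν)` is the square of
    -- `ρ`.
    degree≡ρ²+μ : q ℕ.^ (2 ℕ.* suc ν ℕ.∸ 1) ≡ ρ ℕ.* ρ ℕ.+ μ
    degree≡ρ²+μ = ≡R.begin
      q ℕ.^ (2 ℕ.* suc ν ℕ.∸ 1)                   ≡R.≡⟨ ≡.cong (λ x → q ℕ.^ (x ℕ.∸ 1)) 2ν≡ ⟩
      q ℕ.* q ℕ.^ (ν ℕ.+ ν)                       ≡R.≡⟨ ≡.cong (ℕ._* q ℕ.^ (ν ℕ.+ ν)) (ℕ.m+[n∸m]≡n 0<q) ⟨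
      q ℕ.^ (ν ℕ.+ ν) ℕ.+ (q ℕ.∸ 1) ℕ.* q ℕ.^ (ν ℕ.+ ν)
        ≡R.≡⟨ ≡.cong₂ ℕ._+_ (ℕ.^-distribˡ-+-* q ν ν)
              (≡.trans (ℕ.*-comm (q ℕ.∸ 1) _) (≡.cong (λ x → q ℕ.^ (x ℕ.∸ 2) ℕ.* (q ℕ.∸ 1)) (≡.sym 2ν≡))) ⟩
      ρ ℕ.* ρ ℕ.+ μ                               ≡R.∎
      where
      module ≡R = ≡.≡-Reasoning
      2ν≡ : 2 ℕ.* suc ν ≡ 2 ℕ.+ (ν ℕ.+ ν)
      2ν≡ = ≡.cong suc (≡.trans (ℕ.+-suc ν (ν ℕ.+ 0)) (≡.cong (λ x → suc (ν ℕ.+ x)) (ℕ.+-identityʳ ν)))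

    module _ (L : HeytingField a b d) (char0 : LinearAlgebra.CharacteristicZero L)
             {n} (enum : HasSize (SimpleGraph.vertices (Sp F (suc ν))) n) where
      private
        module S = Spectrum (Sp F (suc ν)) {r = ρ} {m = μ}
          (≡.subst (λ k → IsStronglyRegular (Sp F (suc ν)) (pointCount (2 ℕ.* suc ν)) k μ μ) degree≡ρ²+μ
            (Sp-stronglyRegular (suc ν) (ℕ.s≤s ℕ.z≤n)))
          (ℕ.m^n>0 q ν)
          (ℕ.*-mono-≤ (ℕ.m^n>0 q (2 ℕ.* suc ν ℕ.∸ 2)) (ℕ.m<n⇒0<n∸m 1<q))
          L char0 enum
      open HeytingLinear L using (IsEigenvalue; fromℕ; _≈_; -_; sym; trans; reflexive)

      Sp-spectrum : ∀ t → IsEigenvalue (adjacencyMatrix (Sp F (suc ν)) enum L) t ⇔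
        ( t ≈ fromℕ (q ℕ.^ (2 ℕ.* suc ν ℕ.∸ 1))
        ⊎ (2 ℕ.≤ suc ν × t ≈ fromℕ ρ)
        ⊎ t ≈ - fromℕ ρ)
      Sp-spectrum t = mk⇔ (forward (complete-or-nonAdjacent ν))
        [ (λ t≈κ → S.eigenvalue-resp (sym (trans t≈κ κ≈))
                     (S.κ-eigenvalue (Inverse.to enum (unitPoint (suc ν) zero))))
        , [ (λ (2≤ν , t≈ρ) → S.eigenvalue-resp (sym t≈ρ)
              (ρ-eigenvalue 2≤ν (complete-or-nonAdjacent ν)))
          , (λ t≈-ρ → S.eigenvalue-resp (sym t≈-ρ)
              (S.-ρ-eigenvalue {unitPoint (suc ν) zero} {unitPoint (suc ν) (suc zero)}
                (unitPoints-adjacent ν)))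
          ]′ ]′
        where
        open SimpleGraph (Sp F (suc ν)) using (_≉_; Adj)
        Dichotomy = (ν ≡ 0 × (∀ u w → u ≉ w → Adj u w)) ⊎
                    (2 ℕ.≤ suc ν × ∃₂ λ u w → u ≉ w × ¬ Adj u w)
        κ≈ : fromℕ (q ℕ.^ (2 ℕ.* suc ν ℕ.∸ 1)) ≈ S.κ
        κ≈ = reflexive (≡.cong fromℕ degree≡ρ²+μ)
        forward : Dichotomy → IsEigenvalue S.A t →
          t ≈ fromℕ (q ℕ.^ (2 ℕ.* suc ν ℕ.∸ 1)) ⊎ (2 ℕ.≤ suc ν × t ≈ fromℕ ρ) ⊎ t ≈ - fromℕ ρ
        forward (inj₁ (ν≡0 , complete)) eig =
          Sum.map (λ t≈κ → trans t≈κ (sym κ≈))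
                  -- For `ν ≡ 0` the number `ρ` is `q^0`, so the eigenvalue -1 of the complete graph
                  -- is `- ρ`.
                  (λ t≈-1 → inj₂ (trans t≈-1 (reflexive
                    (≡.cong (λ x → - fromℕ (q ℕ.^ x)) (≡.sym ν≡0)))))
                  (S.complete-eigenvalue-cases complete t eig)
        forward (inj₂ (2≤ν , _)) eig =
          Sum.map (λ t≈κ → trans t≈κ (sym κ≈)) (Sum.map₁ (2≤ν ,_))
                  (S.eigenvalue-cases t eig)
        ρ-eigenvalue : 2 ℕ.≤ suc ν → Dichotomy → IsEigenvalue S.A S.ρ
        ρ-eigenvalue (ℕ.s≤s 1≤ν) (inj₁ (ν≡0 , _)) = contradiction ν≡0 (ℕ.m<n⇒n≢0 1≤ν)
        ρ-eigenvalue _ (inj₂ (_ , u , w , u≉w , ¬adj)) = S.ρ-eigenvalue {u} {w} u≉w ¬adj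

-- The division is exact: `q^n` is one more than the point count times `q ∸ 1`.
order≡ : ∀ {q} (q-pp : IsPrimePower q) (F : FiniteField q c ℓ r) n →
         FiniteLinear.pointCount F n ≡
         ((q ℕ.^ n ℕ.∸ 1) ℕ./ (q ℕ.∸ 1)) {{primePower⇒nonZero-∸1 q-pp}}
order≡ {q = q} q-pp F n = ≡.trans (≡.sym (ℕ.m*n/n≡m (pointCount n) (q ℕ.∸ 1)))
  (≡.cong (λ x → (x ℕ.∸ 1) ℕ./ (q ℕ.∸ 1)) (pointCount-geometric n))
  where
  open FiniteLinear F using (pointCount; pointCount-geometric)
  instance
    _ = primePower⇒nonZero-∸1 q-pp

open import Data.Nat using (ℕ; _≤_; _∸_; _*_; _^_; _/_)

theorem2p1 : ∀ {c ℓ₁ ℓ₂ a b d}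
    (q : ℕ) (q-pp : IsPrimePower q) (F : FiniteField q c ℓ₁ ℓ₂)
    (ν : ℕ) → 1 ≤ ν →
    IsStronglyRegular (Sp F ν)
    (_/_ (q ^ (2 * ν) ∸ 1) (q ∸ 1) {{primePower⇒nonZero-∸1 q-pp}})
    (q ^ (2 * ν ∸ 1))
    (q ^ (2 * ν ∸ 2) * (q ∸ 1))
    (q ^ (2 * ν ∸ 2) * (q ∸ 1))
    ×
    (∀ (L : HeytingField a b d) → LinearAlgebra.CharacteristicZero L →
    ∀ {n} (enum : HasSize (SimpleGraph.vertices (Sp F ν)) n) →
    let open LinearAlgebra L hiding (_*_) in
    ∀ t → IsEigenvalue (adjacencyMatrix (Sp F ν) enum L) t ⇔
    ( t ≈ fromℕ (q ^ (2 * ν ∸ 1))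
    ⊎ (2 ≤ ν × t ≈ fromℕ (q ^ (ν ∸ 1)))
    ⊎ t ≈ - fromℕ (q ^ (ν ∸ 1)) ))
theorem2p1 q q-pp F (suc ν) 1≤ν =
  ≡.subst (λ v → IsStronglyRegular (Sp F (suc ν)) v (q ^ (2 * suc ν ∸ 1)) μ μ) (order≡ q-pp F (2 * suc ν))
          (FiniteLinear.Sp-stronglyRegular F (suc ν) 1≤ν) ,
  -- For a prime power `q ∸ 1` is nonzero, which rules out `q ≤ 1`.
  Sp-spectrum F (ℕ.≰⇒> λ q≤1 →
    ℕ.≢-nonZero⁻¹ (q ∸ 1) {{primePower⇒nonZero-∸1 q-pp}} (ℕ.m≤n⇒m∸n≡0 q≤1)) ν
  where
  μ = q ^ (2 * suc ν ∸ 2) * (q ∸ 1)
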